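{- Let $n\ge 1$ and $0\le\ell\le n$ be integers and $Y_1,\dots,Y_\ell$ indeterminates. Then $$\det M_{n,\ell}(Y_1,\dots,Y_\ell)=\sum_{\pi\in C_{n,\ell}}Y_1^{\alpha_1(\pi)}Y_2^{\alpha_2(\pi)}\cdots Y_\ell^{\alpha_\ell(\pi)}.$$
   Context: Let $\imath=\sqrt{ -1}$. $M_{n,\ell}(\mathbf{Y})$ is the $n\times n$ matrix with rows and columns indexed by $1,\dots,n$ whose $(k,j)$ entry is $\imath^{\,j-k}Y_{j-k+1}$ if $0\le j-k\le \ell-1$, is $\imath\, j$ if $k=j+1$, and is $0$ otherwise. $C_{n,\ell}$ is the set of permutations $\pi\in\mathfrak{S}_n$ all of whose cycles in the disjoint cycle decomposition have length at most $\ell$, and $\alpha_t(\pi)$ is the number of cycles of length $t$ in $\pi$. -}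

module Defs where

open import Algebra.Bundles using (CommutativeRing)
open import Data.Nat as ℕ using (ℕ; zero; suc; _∸_; _≡ᵇ_; _≤ᵇ_; _<ᵇ_)
open import Data.Fin using (Fin; zero; suc; toℕ; fromℕ<)
open import Data.Bool using (Bool; true; false; if_then_else_; _∧_; _∨_; not)
open import Data.List using (List; []; _∷_; map; concatMap; foldr; allFin; upTo; filterᵇ; length)
open import Relation.Nullary using (yes; no)

allFns : (m k : ℕ) → List (Fin m → Fin k)
allFns zero    k = (λ ()) ∷ []
allFns (suc m) k = concatMap (λ f → map (λ x → cons x f) (allFin k)) (allFns m k)
  where
  cons : Fin k → (Fin m → Fin k) → Fin (suc m) → Fin k
  cons x f zero    = x
  cons x f (suc i) = f i

all : ∀ {a} {A : Set a} → (A → Bool) → List A → Bool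
all p = foldr (λ x b → p x ∧ b) true

_==F_ : ∀ {n} → Fin n → Fin n → Bool
a ==F b = toℕ a ≡ᵇ toℕ b

isInjective : ∀ {n} → (Fin n → Fin n) → Bool
isInjective {n} f =
  all (λ i → all (λ j → (i ==F j) ∨ not (f i ==F f j)) (allFin n)) (allFin n)

-- the symmetric group 𝔖_n, as the (duplicate-free) list of all bijections
perms : (n : ℕ) → List (Fin n → Fin n)
perms n = filterᵇ isInjective (allFns n n)

count : ∀ {a} {A : Set a} → (A → Bool) → List A → ℕ
count p xs = length (filterᵇ p xs)

sumℕ : List ℕ → ℕ
sumℕ = foldr ℕ._+_ 0

inversions : ∀ {n} → (Fin n → Fin n) → ℕ
inversions {n} f =
  sumℕ (map (λ i → count (λ j → (toℕ i <ᵇ toℕ j) ∧ (toℕ (f j) <ᵇ toℕ (f i))) (allFin n)) (allFin n))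

iter : ∀ {n} → (Fin n → Fin n) → ℕ → Fin n → Fin n
iter f zero    k = k
iter f (suc m) k = f (iter f m k)

firstReturn : ∀ {n} → (Fin n → Fin n) → Fin n → (start fuel : ℕ) → ℕ
firstReturn f k t zero       = 0
firstReturn f k t (suc fuel) = if iter f t k ==F k then t else firstReturn f k (suc t) fuel

-- length of the cycle of π containing k (for a permutation of Fin n this is in 1..n)
cycleLen : ∀ {n} → (Fin n → Fin n) → Fin n → ℕ
cycleLen {n} f k = firstReturn f k 1 n

-- k is the smallest element of its cycle (used to pick one representative per cycle)
isCycleMin : ∀ {n} → (Fin n → Fin n) → Fin n → Bool
isCycleMin f k = all (λ m → toℕ k ≤ᵇ toℕ (iter f m k)) (upTo (cycleLen f k))

α : ∀ {n} → (Fin n → Fin n) → ℕ → ℕ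
α {n} f t = count (λ k → (cycleLen f k ≡ᵇ t) ∧ isCycleMin f k) (allFin n)

inC : ∀ {n} → ℕ → (Fin n → Fin n) → Bool
inC {n} ℓ f = all (λ k → cycleLen f k ≤ᵇ ℓ) (allFin n)

C : (n ℓ : ℕ) → List (Fin n → Fin n)
C n ℓ = filterᵇ (inC ℓ) (perms n)

module _ {c ℓ′} (R : CommutativeRing c ℓ′) where
  open CommutativeRing R

  pow : Carrier → ℕ → Carrier
  pow x zero    = 1#
  pow x (suc m) = x * pow x m

  ofℕ : ℕ → Carrier
  ofℕ zero    = 0#
  ofℕ (suc m) = 1# + ofℕ m

  ∑ : ∀ {a} {A : Set a} → List A → (A → Carrier) → Carrier
  ∑ xs g = foldr (λ x acc → g x + acc) 0# xs

  ∏ : ∀ {a} {A : Set a} → List A → (A → Carrier) → Carrier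
  ∏ xs g = foldr (λ x acc → g x * acc) 1# xs

  det : (n : ℕ) → (Fin n → Fin n → Carrier) → Carrier
  det n A = ∑ (perms n) (λ σ → pow (- 1#) (inversions σ) * ∏ (allFin n) (λ k → A k (σ k)))

  -- M_{n,ℓ}(Y) with ι ∈ R playing √-1.  Rows/columns are 0-indexed: the
  -- paper's (k,j) entry is entry k' j' with k = k'+1, j = j'+1; Y_{d+1} is Y d.
  --   (k,j) = ι^{j-k} Y_{j-k+1}  if 0 ≤ j-k ≤ ℓ-1
  --         = ι · j              if k = j+1
  --         = 0                  otherwise
  M : (ι : Carrier) (n ℓ : ℕ) → (Fin ℓ → Carrier) → Fin n → Fin n → Carrier
  M ι n ℓ Y k j with toℕ k ℕ.≤? toℕ j | (toℕ j ∸ toℕ k) ℕ.<? ℓ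
  ... | yes _ | yes d<ℓ = pow ι (toℕ j ∸ toℕ k) * Y (fromℕ< d<ℓ)
  ... | _     | _       = if toℕ k ≡ᵇ suc (toℕ j) then ι * ofℕ (suc (toℕ j)) else 0#

  cycleSum : (n ℓ : ℕ) → (Fin ℓ → Carrier) → Carrier
  cycleSum n ℓ Y = ∑ (C n ℓ) (λ π → ∏ (allFin ℓ) (λ t → pow (Y t) (α π (suc (toℕ t)))))

{-# OPTIONS --safe #-}
module Submission where

-- Write y t for Y t when 1 ≤ t ≤ ℓ and for 0 otherwise. Both sides satisfy the recursion
--   D (n + 1) = E 0 n,   E s n = y (s + 1) D n + n E (s + 1) (n - 1).
-- For the permutations, E s n sums over 𝔖_{n+1} with the cycle through a marked point
-- weighted as if it were s elements longer: either the marked point is fixed, or its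
-- successor, one of the n other points, is contracted out of the cycle. For the matrices,
-- E s n is the determinant of size n + 1 with Y_{d+1} replaced by Y_{d+1+s} in the last
-- column. Its last row has two non-zero entries; deleting the subdiagonal one, ι n,
-- leaves the matrix of E (s + 1) (n - 1) with last column multiplied by ι, and
-- - ι n · ι = n.

open import Defs hiding (C)
open import Algebra.Bundles using (CommutativeRing; CommutativeMonoid)
open import Data.Bool using (Bool; true; false; T; if_then_else_; _∧_; _∨_; not)
open import Data.Bool.Properties using (T-∧; T-∨; T?; ∧-zeroʳ; ∧-identityʳ)
open import Data.Fin using (Fin; zero; suc; toℕ; fromℕ; fromℕ<; punchIn; punchOut; _≟_)
open import Data.Fin.Properties
  using (toℕ-injective; toℕ<n; toℕ-fromℕ; toℕ-fromℕ<; any?; pigeonhole; suc-injective; punchIn-injective; punchInᵢ≢i;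
         punchIn-mono-≤; punchIn-cancel-≤; punchIn-punchOut; punchOut-punchIn; punchOut-cong; punchOut-injective)
open import Data.List using (List; []; _∷_; _++_; map; foldr; filterᵇ; tabulate; allFin; concatMap; cartesianProductWith; upTo)
open import Data.List.Membership.Propositional using (_∈_)
open import Data.List.Membership.Propositional.Properties using (∈-allFin; ∈-upTo⁺)
import Data.List.Membership.Setoid as SetoidMembership
open import Data.List.Membership.Setoid.Properties
  using (∈-∃++; ∈-cartesianProductWith⁺; ∈-cartesianProductWith⁻; ∈-filter⁺; ∈-filter⁻; ∈-map⁺; ∈-map⁻; ∈-resp-≈)
import Data.List.Relation.Binary.Permutation.Homogeneous as ↭
import Data.List.Relation.Binary.Permutation.Setoid as SetoidPermutation
import Data.List.Relation.Binary.Permutation.Setoid.Properties as SetoidPermutationProperties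
open import Data.List.Relation.Binary.Pointwise using ([]; _∷_)
open import Data.List.Relation.Unary.All as All using (All; []; _∷_)
open import Data.List.Relation.Unary.All.Properties using (All¬⇒¬Any; all-filter)
open import Data.List.Relation.Unary.AllPairs using ([]; _∷_)
open import Data.List.Relation.Unary.Any using (here; there)
open import Data.List.Relation.Unary.Unique.Setoid using (Unique)
import Data.List.Relation.Unary.Unique.Setoid.Properties as Uniqueₚ
open import Data.Nat as ℕ
  using (ℕ; zero; suc; _∸_; _%_; _/_; _≤_; _<_; _≤ᵇ_; _<ᵇ_; _≡ᵇ_; _≤?_; _<?_; z≤n; s≤s; z<s; s<s; >-nonZero)
open import Data.Nat.DivMod using (m≡m%n+[m/n]*n; m%n<n)
open import Data.Nat.Properties as ℕₚ
  using (<-cmp; ≤-refl; ≤-trans; ≤-reflexive; <-irrefl; <⇒≤; <⇒≱; <⇒≢; ≤-pred; ≤∧≢⇒<; ≮⇒≥; n<1+n; m≤n⇒m<n∨m≡n;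
         m<n⇒0<n∸m; m∸n≤m; n∸n≡0; m+[n∸m]≡n; ≤⇒≤ᵇ; ≤ᵇ⇒≤; <⇒<ᵇ; <ᵇ⇒<; ≡ᵇ⇒≡; ≡⇒≡ᵇ)
open import Data.Product using (_×_; _,_; proj₁; proj₂; ∃)
open import Data.Sum using (_⊎_; inj₁; inj₂)
open import Function using (_∘_; id; Injective; flip)
open import Function.Bundles using (Equivalence)
open import Level using (Level)
open import Relation.Binary.Bundles using (Setoid)
open import Relation.Binary.Definitions using (tri<; tri≈; tri>)
open import Relation.Binary.PropositionalEquality as ≡ using (_≡_; _≢_; _≗_; _→-setoid_)
open import Relation.Nullary using (¬_; yes; no; contradiction)

-- The shift s is forced on both sides. Contracting a point shortens the marked cycle by one, and
-- deleting a subdiagonal entry with its row and column leaves a last column whose powers of ι and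
-- indices of y are one too high; s records this excess. The marked point is `zero`: being smallest,
-- it always represents its own cycle. The expansion uses the last row, so that the inversions
-- involving it can be split off without renumbering the other positions.
--
-- Setting y to 0 above ℓ removes ℓ from both recursions: a permutation with a long cycle has weight
-- 0, and the band of the matrix needs no bound.
--
-- Contraction is not plain deletion in one-line notation. Removing position `zero` and value
-- `suc z` leaves positions and values with different labels. A relabelling of the positions,
-- depending only on z, repairs this; it only permutes the symmetric group, so the sum is unchanged.

private
  variable
    a b d : Level
    A B D : Set a
    n : ℕ

-- Finite sums and the enumeration of permutations

module _ {c ℓ} (S : Setoid c ℓ) where
  open Setoid S using () renaming (refl to ≈-refl; sym to ≈-sym)
  open SetoidMembership S renaming (_∈_ to _∈ₛ_)
  open SetoidPermutation S
  open SetoidPermutationProperties S using (shift; Unique-resp-↭; ∈-resp-↭)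

  private
    extract : ∀ {v xs} → v ∈ₛ xs → ∃ λ zs → xs ↭ v ∷ zs
    extract v∈xs with ∈-∃++ S v∈xs
    ... | as , bs , w , v≈w , xs≋ = as ++ bs , ↭-trans (↭-reflexive-≋ xs≋) (shift (≈-sym v≈w) as bs)

  -- Permutations are functions compared pointwise, so reindexing a sum over them means comparing
  -- lists in a setoid, and this reduces the comparison to membership. The head of `xs` is located
  -- in `ys`; absence of duplicates keeps the two remainders equal as sets.
  unique∧set⇒↭ : ∀ {xs ys} → Unique S xs → Unique S ys →
                 (∀ {z} → z ∈ₛ xs → z ∈ₛ ys) → (∀ {z} → z ∈ₛ ys → z ∈ₛ xs) → xs ↭ ys
  unique∧set⇒↭ {[]} {[]}     _ _ _ _ = ↭-refl
  unique∧set⇒↭ {[]} {y ∷ ys} _ _ _ ys⊆xs with () ← ys⊆xs (here ≈-refl)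
  unique∧set⇒↭ {x ∷ xs} {ys} (x∉xs ∷ xs!) ys! xs⊆ys ys⊆xs
    with zs , ys↭ ← extract (xs⊆ys (here ≈-refl))
    with x∉zs ∷ zs! ← Unique-resp-↭ ys↭ ys! =
    ↭-trans (↭-prep x (unique∧set⇒↭ xs! zs! xs⊆zs zs⊆xs)) (↭-sym ys↭)
    where
    xs⊆zs : ∀ {z} → z ∈ₛ xs → z ∈ₛ zs
    xs⊆zs z∈xs with ∈-resp-↭ ys↭ (xs⊆ys (there z∈xs))
    ... | here z≈x = contradiction (∈-resp-≈ S z≈x z∈xs) (All¬⇒¬Any x∉xs)
    ... | there z∈zs = z∈zs
    zs⊆xs : ∀ {z} → z ∈ₛ zs → z ∈ₛ xs
    zs⊆xs z∈zs with ys⊆xs (∈-resp-↭ (↭-sym ys↭) (there z∈zs))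
    ... | here z≈x = contradiction (∈-resp-≈ S z≈x z∈zs) (All¬⇒¬Any x∉zs)
    ... | there z∈xs = z∈xs

module Fold {c ℓ} (M : CommutativeMonoid c ℓ) where
  open CommutativeMonoid M
  open import Algebra.Properties.CommutativeMonoid.Sum M public
    using (sum; sum-remove; sum-cong-≋; ∑-distrib-+; ∑-comm)
  open import Algebra.Properties.CommutativeSemigroup commutativeSemigroup using (x∙yz≈y∙xz)

  fold : List A → (A → Carrier) → Carrier
  fold xs g = foldr (λ x acc → g x ∙ acc) ε xs

  fold-cong : ∀ {xs : List A} {g h} → All (λ x → g x ≈ h x) xs → fold xs g ≈ fold xs h
  fold-cong []       = refl
  fold-cong (e ∷ es) = ∙-cong e (fold-cong es)

  fold-cong′ : ∀ (xs : List A) {g h} → (∀ x → g x ≈ h x) → fold xs g ≈ fold xs h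
  fold-cong′ xs e = fold-cong (All.universal e xs)

  fold-++ : ∀ (xs ys : List A) g → fold (xs ++ ys) g ≈ fold xs g ∙ fold ys g
  fold-++ []       ys g = sym (identityˡ _)
  fold-++ (x ∷ xs) ys g = trans (∙-congˡ (fold-++ xs ys g)) (sym (assoc _ _ _))

  fold-map : ∀ (f : A → B) xs g → fold (map f xs) g ≈ fold xs (g ∘ f)
  fold-map f []       g = refl
  fold-map f (x ∷ xs) g = ∙-congˡ (fold-map f xs g)

  fold-cartesianProductWith : ∀ (f : A → B → D) xs ys g →
    fold (cartesianProductWith f xs ys) g ≈ fold xs (λ x → fold ys (λ y → g (f x y)))
  fold-cartesianProductWith f []       ys g = refl
  fold-cartesianProductWith f (x ∷ xs) ys g = trans (fold-++ (map (f x) ys) _ g)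
    (∙-cong (fold-map (f x) ys g) (fold-cartesianProductWith f xs ys g))

  fold-tabulate : ∀ (f : Fin n → A) g → fold (tabulate f) g ≈ sum (g ∘ f)
  fold-tabulate {n = zero}  f g = refl
  fold-tabulate {n = suc n} f g = ∙-congˡ (fold-tabulate (f ∘ suc) g)

  fold-filter : ∀ (p : A → Bool) xs g →
    fold (filterᵇ p xs) g ≈ fold xs (λ x → if p x then g x else ε)
  fold-filter p []       g = refl
  fold-filter p (x ∷ xs) g with p x
  ... | true  = ∙-congˡ (fold-filter p xs g)
  ... | false = trans (fold-filter p xs g) (sym (identityˡ _))

  sum-ε : ∀ {t : Fin n → Carrier} → (∀ i → t i ≈ ε) → sum t ≈ ε
  sum-ε {n = zero}  e = refl
  sum-ε {n = suc n} e = trans (∙-cong (e zero) (sum-ε (e ∘ suc))) (identityˡ _)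

  sum-only : ∀ (i : Fin (suc n)) {t} → (∀ j → t (punchIn i j) ≈ ε) → sum t ≈ t i
  sum-only i {t} e = trans (sum-remove {i = i} t) (trans (∙-congˡ (sum-ε e)) (identityʳ _))

  module _ {s r} (S : Setoid s r) where
    open SetoidPermutation S using (_↭_)
    open Setoid S using () renaming (Carrier to X; _≈_ to _∼_)

    fold-↭ : ∀ {g : X → Carrier} → (∀ {x y} → x ∼ y → g x ≈ g y) →
             ∀ {xs ys} → xs ↭ ys → fold xs g ≈ fold ys g
    fold-↭ g-cong (↭.refl [])          = refl
    fold-↭ g-cong (↭.refl (e ∷ es))    = ∙-cong (g-cong e) (fold-↭ g-cong (↭.refl es))
    fold-↭ g-cong (↭.prep e xs↭)       = ∙-cong (g-cong e) (fold-↭ g-cong xs↭)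
    fold-↭ g-cong (↭.swap e₁ e₂ xs↭)   = trans (x∙yz≈y∙xz _ _ _)
      (∙-cong (g-cong e₂) (∙-cong (g-cong e₁) (fold-↭ g-cong xs↭)))
    fold-↭ g-cong (↭.trans xs↭ ys↭)    = trans (fold-↭ g-cong xs↭) (fold-↭ g-cong ys↭)

-- Permutations built by inserting one position and one value

IsInjective : (Fin n → Fin n) → Set
IsInjective f = Injective _≡_ _≡_ f

-- In terms of permutation matrices, row r and column x are added to that of ρ, with the new 1 where
-- they cross. With r last this drives the determinant expansion, with r `zero` the insertion of a
-- point into a cycle.
insert : Fin (suc n) → Fin (suc n) → (Fin n → Fin n) → Fin (suc n) → Fin (suc n)
insert r x ρ k with r ≟ k
... | yes _  = x
... | no r≢k = punchIn x (ρ (punchOut r≢k))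

insert-at : ∀ (r x : Fin (suc n)) ρ → insert r x ρ r ≡ x
insert-at r x ρ with r ≟ r
... | yes _  = ≡.refl
... | no r≢r = contradiction ≡.refl r≢r

insert-punchIn : ∀ (r x : Fin (suc n)) ρ j → insert r x ρ (punchIn r j) ≡ punchIn x (ρ j)
insert-punchIn r x ρ j with r ≟ punchIn r j
... | yes r≡ = contradiction (≡.sym r≡) (punchInᵢ≢i r j)
... | no r≢  = ≡.cong (punchIn x ∘ ρ) (≡.trans (punchOut-cong r ≡.refl) (punchOut-punchIn r))

punchIn-view : ∀ (r k : Fin (suc n)) → k ≡ r ⊎ ∃ λ j → k ≡ punchIn r j
punchIn-view r k with r ≟ k
... | yes r≡k = inj₁ (≡.sym r≡k)
... | no r≢k  = inj₂ (punchOut r≢k , ≡.sym (punchIn-punchOut r≢k))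

insert-unique : ∀ (r x : Fin (suc n)) ρ {f} → f r ≡ x → (∀ j → f (punchIn r j) ≡ punchIn x (ρ j)) →
                f ≗ insert r x ρ
insert-unique r x ρ fr fj k with punchIn-view r k
... | inj₁ ≡.refl       = ≡.trans fr (≡.sym (insert-at r x ρ))
... | inj₂ (j , ≡.refl) = ≡.trans (fj j) (≡.sym (insert-punchIn r x ρ j))

insert-cong : ∀ (r : Fin (suc n)) {x y ρ σ} → x ≡ y → ρ ≗ σ → insert r x ρ ≗ insert r y σ
insert-cong r {x} {_} {ρ} {σ} ≡.refl ρ≗σ = insert-unique r x σ (insert-at r x ρ)
  (λ j → ≡.trans (insert-punchIn r x ρ j) (≡.cong (punchIn x) (ρ≗σ j)))

insert-isInjective : ∀ (r x : Fin (suc n)) {ρ} → IsInjective ρ → IsInjective (insert r x ρ)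
insert-isInjective r x {ρ} ρ-inj {k} {l} eq with punchIn-view r k | punchIn-view r l
... | inj₁ ≡.refl | inj₁ ≡.refl = ≡.refl
... | inj₁ ≡.refl | inj₂ (j , ≡.refl) =
  contradiction (≡.trans (≡.sym (insert-punchIn r x ρ j)) (≡.trans (≡.sym eq) (insert-at r x ρ))) (punchInᵢ≢i x (ρ j))
... | inj₂ (i , ≡.refl) | inj₁ ≡.refl =
  contradiction (≡.trans (≡.sym (insert-punchIn r x ρ i)) (≡.trans eq (insert-at r x ρ))) (punchInᵢ≢i x (ρ i))
... | inj₂ (i , ≡.refl) | inj₂ (j , ≡.refl) =
  ≡.cong (punchIn r) (ρ-inj (punchIn-injective x _ _
    (≡.trans (≡.sym (insert-punchIn r x ρ i)) (≡.trans eq (insert-punchIn r x ρ j)))))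

insert-injective : ∀ (r : Fin (suc n)) {x y ρ σ} → insert r x ρ ≗ insert r y σ → x ≡ y × ρ ≗ σ
insert-injective r {x} {y} {ρ} {σ} eq with ≡.trans (≡.sym (insert-at r x ρ)) (≡.trans (eq r) (insert-at r y σ))
... | ≡.refl = ≡.refl , λ j → punchIn-injective x _ _
  (≡.trans (≡.sym (insert-punchIn r x ρ j)) (≡.trans (eq (punchIn r j)) (insert-punchIn r x σ j)))

insert-surjective : ∀ (r : Fin (suc n)) {f} → IsInjective f →
                    ∃ λ ρ → IsInjective ρ × f ≗ insert r (f r) ρ
insert-surjective r {f} f-inj = ρ , ρ-inj , insert-unique r (f r) ρ ≡.refl
    (λ j → ≡.sym (punchIn-punchOut (fr≢ j)))
  where
  fr≢ : ∀ j → f r ≢ f (punchIn r j)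
  fr≢ j eq = punchInᵢ≢i r j (≡.sym (f-inj eq))
  ρ : Fin _ → Fin _
  ρ j = punchOut (fr≢ j)
  ρ-inj : IsInjective ρ
  ρ-inj {i} {j} eq = punchIn-injective r _ _ (f-inj (punchOut-injective (fr≢ i) (fr≢ j) eq))

isInjective-surjective : ∀ {n} {f : Fin n → Fin n} → IsInjective f → ∀ k → ∃ λ i → f i ≡ k
isInjective-surjective {suc n} {f} f-inj k with insert-surjective zero f-inj
... | ρ , ρ-inj , f≗ with punchIn-view (f zero) k
... | inj₁ k≡ = zero , ≡.sym k≡
... | inj₂ (j , ≡.refl) with i , ρi≡j ← isInjective-surjective ρ-inj j =
  suc i , ≡.trans (f≗ (suc i)) (≡.trans (insert-punchIn zero (f zero) ρ i) (≡.cong (punchIn (f zero)) ρi≡j))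

module _ {c ℓ} (M : CommutativeMonoid c ℓ) where
  open CommutativeMonoid M
  open Fold M

  -- Splitting off position `zero` leaves an injection ρ on the points other than `f zero`, so
  -- induction applies to `t ∘ punchIn (f zero)`.
  sum-reindex : ∀ {n} {f : Fin n → Fin n} → IsInjective f → ∀ t → sum (t ∘ f) ≈ sum t
  sum-reindex {zero}      f-inj t = refl
  sum-reindex {suc n} {f} f-inj t with insert-surjective zero f-inj
  ... | ρ , ρ-inj , f≗ = trans
    (∙-congˡ (trans
      (sum-cong-≋ (λ j → reflexive (≡.cong t (≡.trans (f≗ (suc j)) (insert-punchIn zero (f zero) ρ j)))))
      (sum-reindex ρ-inj (t ∘ punchIn (f zero)))))
    (sym (sum-remove {i = f zero} t))

-- Boolean tests, and `perms` as a complete list without duplicates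

all⁺ : ∀ (p : A → Bool) xs → (∀ {x} → x ∈ xs → T (p x)) → T (all p xs)
all⁺ p []       h = _
all⁺ p (x ∷ xs) h = Equivalence.from T-∧ (h (here ≡.refl) , all⁺ p xs (h ∘ there))

all⁻ : ∀ (p : A → Bool) xs → T (all p xs) → ∀ {x} → x ∈ xs → T (p x)
all⁻ p (x ∷ xs) t (here ≡.refl) = proj₁ (Equivalence.to T-∧ t)
all⁻ p (x ∷ xs) t (there y∈xs)  = all⁻ p xs (proj₂ (Equivalence.to (T-∧ {p x}) t)) y∈xs

==F⇒≡ : ∀ (i j : Fin n) → T (i ==F j) → i ≡ j
==F⇒≡ i j t = toℕ-injective (≡ᵇ⇒≡ _ _ t)

≡⇒==F : ∀ {i j : Fin n} → i ≡ j → T (i ==F j)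
≡⇒==F {i = i} ≡.refl = ≡⇒≡ᵇ (toℕ i) (toℕ i) ≡.refl

private
  separates : (Fin n → Fin n) → Fin n → Fin n → Bool
  separates f i j = (i ==F j) ∨ not (f i ==F f j)

  T-not : ∀ {x} → T (not x) → ¬ T x
  T-not {false} _ ()

  T-not⁺ : ∀ {x} → ¬ T x → T (not x)
  T-not⁺ {false} _ = _
  T-not⁺ {true}  h = h _

isInjective⁻ : ∀ (f : Fin n → Fin n) → T (isInjective f) → IsInjective f
isInjective⁻ f t {i} {j} fi≡fj with Equivalence.to T-∨ (all⁻ (separates f i) _ (all⁻ (λ k → all (separates f k) (allFin _)) _ t (∈-allFin i)) (∈-allFin j))
... | inj₁ i==j = ==F⇒≡ i j i==j
... | inj₂ fi≠fj = contradiction (≡⇒==F fi≡fj) (T-not fi≠fj)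

isInjective⁺ : ∀ {f : Fin n → Fin n} → IsInjective f → T (isInjective f)
isInjective⁺ {f = f} f-inj = all⁺ _ (allFin _) λ {i} _ → all⁺ (separates f i) (allFin _) λ {j} _ → lemma i j
  where
  lemma : ∀ i j → T (separates f i j)
  lemma i j with i ≟ j
  ... | yes i≡j = Equivalence.from T-∨ (inj₁ (≡⇒==F i≡j))
  ... | no i≢j  = Equivalence.from (T-∨ {i ==F j}) (inj₂ (T-not⁺ (i≢j ∘ f-inj ∘ ==F⇒≡ (f i) (f j))))

Fns : ℕ → ℕ → Setoid _ _
Fns m k = Fin m →-setoid Fin k

-- The list concatenation step of allFns, with its inaccessible local cons as a variable.
module _ {m k} (cons : Fin k → (Fin m → Fin k) → Fin (suc m) → Fin k)
         (cons-zero : ∀ x f → cons x f zero ≡ x) (cons-suc : ∀ x f i → cons x f (suc i) ≡ f i) where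
  open SetoidMembership (Fns m k) renaming (_∈_ to _∈ₘ_)
  open SetoidMembership (Fns (suc m) k) renaming (_∈_ to _∈ₛ_)

  extend : List (Fin m → Fin k) → List (Fin (suc m) → Fin k)
  extend = concatMap (λ f → map (λ x → cons x f) (allFin k))

  extend≡ : ∀ fs → extend fs ≡ cartesianProductWith (flip cons) fs (allFin k)
  extend≡ []       = ≡.refl
  extend≡ (f ∷ fs) = ≡.cong (map (λ x → cons x f) (allFin k) ++_) (extend≡ fs)

  extend-unique : ∀ {fs} → Unique (Fns m k) fs → Unique (Fns (suc m) k) (extend fs)
  extend-unique {fs} fs! rewrite extend≡ fs =
    Uniqueₚ.cartesianProductWith⁺ (Fns m k) (≡.setoid (Fin k)) (Fns (suc m) k) (flip cons)
      (λ {f} {g} {x} {y} eq →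
        (λ i → ≡.trans (≡.sym (cons-suc x f i)) (≡.trans (eq (suc i)) (cons-suc y g i))) ,
        ≡.trans (≡.sym (cons-zero x f)) (≡.trans (eq zero) (cons-zero y g)))
      fs! (Uniqueₚ.tabulate⁺ (≡.setoid (Fin k)) id)

  extend-complete : ∀ {fs} → (∀ f → f ∈ₘ fs) → ∀ f → f ∈ₛ extend fs
  extend-complete {fs} h f rewrite extend≡ fs =
    ∈-resp-≈ (Fns (suc m) k) cons≗f
      (∈-cartesianProductWith⁺ (Fns m k) (≡.setoid (Fin k)) (Fns (suc m) k) cons-cong
        (h (f ∘ suc)) (∈-allFin (f zero)))
    where
    cons≗f : cons (f zero) (f ∘ suc) ≗ f
    cons≗f zero    = cons-zero _ _
    cons≗f (suc i) = cons-suc _ _ i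
    cons-cong : ∀ {f g x y} → f ≗ g → x ≡ y → cons x f ≗ cons y g
    cons-cong e ≡.refl zero    = ≡.trans (cons-zero _ _) (≡.sym (cons-zero _ _))
    cons-cong e ≡.refl (suc i) = ≡.trans (cons-suc _ _ i) (≡.trans (e i) (≡.sym (cons-suc _ _ i)))

allFns-unique : ∀ m k → Unique (Fns m k) (allFns m k)
allFns-unique zero    k = [] ∷ []
allFns-unique (suc m) k = extend-unique _ (λ _ _ → ≡.refl) (λ _ _ _ → ≡.refl) (allFns-unique m k)

allFns-complete : ∀ m k f → SetoidMembership._∈_ (Fns m k) f (allFns m k)
allFns-complete zero    k f = here λ ()
allFns-complete (suc m) k f =
  extend-complete _ (λ _ _ → ≡.refl) (λ _ _ _ → ≡.refl) (allFns-complete m k) f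

module _ (n : ℕ) where
  open SetoidMembership (Fns n n) renaming (_∈_ to _∈ₛ_)

  private
    isInjective-resp : ∀ {f g : Fin n → Fin n} → f ≗ g → T (isInjective f) → T (isInjective g)
    isInjective-resp {f} f≗g t = isInjective⁺ λ {i} {j} eq →
      isInjective⁻ f t (≡.trans (f≗g i) (≡.trans eq (≡.sym (f≗g j))))

  perms-unique : Unique (Fns n n) (perms n)
  perms-unique = Uniqueₚ.filter⁺ (Fns n n) (T? ∘ isInjective) (allFns-unique n n)

  ∈-perms⁺ : ∀ {f} → IsInjective f → f ∈ₛ perms n
  ∈-perms⁺ {f} f-inj = ∈-filter⁺ (Fns n n) (T? ∘ isInjective) isInjective-resp
    (allFns-complete n n f) (isInjective⁺ f-inj)

  ∈-perms⁻ : ∀ {f} → f ∈ₛ perms n → IsInjective f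
  ∈-perms⁻ f∈ = isInjective⁻ _ (proj₂ (∈-filter⁻ (Fns n n) (T? ∘ isInjective) isInjective-resp {xs = allFns n n} f∈))

  perms-isInjective : All IsInjective (perms n)
  perms-isInjective = All.map (isInjective⁻ _) (all-filter (T? ∘ isInjective) (allFns n n))

module _ {c ℓ} (M : CommutativeMonoid c ℓ) where
  open CommutativeMonoid M
  open Fold M

  -- For fixed r, a permutation of n + 1 points amounts to its value x at r and the permutation left
  -- after deleting position r and value x.
  fold-perms-insert : ∀ (r : Fin (suc n)) {w} → (∀ {f g} → f ≗ g → w f ≈ w g) →
    fold (perms (suc n)) w ≈ sum (λ x → fold (perms n) (λ ρ → w (insert r x ρ)))
  fold-perms-insert {n} r {w} w-cong = trans
    (fold-↭ (Fns (suc n) (suc n)) w-cong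
      (unique∧set⇒↭ (Fns (suc n) (suc n)) (perms-unique (suc n)) products-unique products⁺ products⁻))
    (trans (fold-cartesianProductWith (insert r) (allFin (suc n)) (perms n) w) (fold-tabulate {n = suc n} id (λ x → fold (perms n) (λ ρ → w (insert r x ρ)))))
    where
    products : List (Fin (suc n) → Fin (suc n))
    products = cartesianProductWith (insert r) (allFin (suc n)) (perms n)
    open SetoidMembership (Fns (suc n) (suc n)) renaming (_∈_ to _∈ₛ_)

    products-unique : Unique (Fns (suc n) (suc n)) products
    products-unique = Uniqueₚ.cartesianProductWith⁺ (≡.setoid (Fin (suc n))) (Fns n n) (Fns (suc n) (suc n))
      (insert r) (insert-injective r) (Uniqueₚ.tabulate⁺ (≡.setoid (Fin (suc n))) id) (perms-unique n)

    products⁺ : ∀ {f} → f ∈ₛ perms (suc n) → f ∈ₛ products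
    products⁺ {f} f∈ with ρ , ρ-inj , f≗ ← insert-surjective r (∈-perms⁻ (suc n) f∈) =
      ∈-resp-≈ (Fns (suc n) (suc n)) (λ k → ≡.sym (f≗ k))
        (∈-cartesianProductWith⁺ (≡.setoid (Fin (suc n))) (Fns n n) (Fns (suc n) (suc n))
          (insert-cong r) (∈-allFin (f r)) (∈-perms⁺ n ρ-inj))

    products⁻ : ∀ {f} → f ∈ₛ products → f ∈ₛ perms (suc n)
    products⁻ {f} f∈ with ∈-cartesianProductWith⁻ (≡.setoid (Fin (suc n))) (Fns n n) (Fns (suc n) (suc n))
                            (insert r) (allFin (suc n)) (perms n) f∈
    ... | x , ρ , _ , ρ∈ , f≗ =
      ∈-resp-≈ (Fns (suc n) (suc n)) (λ k → ≡.sym (f≗ k)) (∈-perms⁺ (suc n) (insert-isInjective r x (∈-perms⁻ n ρ∈)))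

  -- Right translation by an invertible g permutes the symmetric group; h supplies the preimage
  -- `f ∘ h` of a given f.
  fold-perms-∘ : ∀ {g h : Fin n → Fin n} → g ∘ h ≗ id → h ∘ g ≗ id →
    ∀ {w} → (∀ {f f′} → f ≗ f′ → w f ≈ w f′) → fold (perms n) w ≈ fold (perms n) (λ ρ → w (ρ ∘ g))
  fold-perms-∘ {n} {g} {h} gh hg {w} w-cong = trans
    (fold-↭ (Fns n n) w-cong (unique∧set⇒↭ (Fns n n) (perms-unique n) composites-unique composites⁺ composites⁻))
    (fold-map (_∘ g) (perms n) w)
    where
    open SetoidMembership (Fns n n) renaming (_∈_ to _∈ₛ_)

    composites-unique : Unique (Fns n n) (map (_∘ g) (perms n))
    composites-unique = Uniqueₚ.map⁺ (Fns n n) (Fns n n)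
      (λ {p} {q} eq i → ≡.trans (≡.cong p (≡.sym (gh i))) (≡.trans (eq (h i)) (≡.cong q (gh i)))) (perms-unique n)

    composites⁺ : ∀ {f} → f ∈ₛ perms n → f ∈ₛ map (_∘ g) (perms n)
    composites⁺ {f} f∈ = ∈-resp-≈ (Fns n n) (λ i → ≡.cong f (hg i))
      (∈-map⁺ (Fns n n) (Fns n n) (λ eq i → eq (g i))
        (∈-perms⁺ n {f ∘ h} (λ eq → ≡.trans (≡.sym (gh _)) (≡.trans (≡.cong g (∈-perms⁻ n f∈ eq)) (gh _)))))

    composites⁻ : ∀ {f} → f ∈ₛ map (_∘ g) (perms n) → f ∈ₛ perms n
    composites⁻ f∈ with ρ , ρ∈ , f≗ ← ∈-map⁻ (Fns n n) (Fns n n) f∈ =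
      ∈-resp-≈ (Fns n n) (λ i → ≡.sym (f≗ i)) (∈-perms⁺ n (λ eq → ≡.trans (≡.sym (hg _)) (≡.trans (≡.cong h (∈-perms⁻ n ρ∈ eq)) (hg _))))

-- Cycles

iter-cong : ∀ {f g : Fin n → Fin n} → f ≗ g → ∀ m k → iter f m k ≡ iter g m k
iter-cong f≗g zero    k = ≡.refl
iter-cong {f = f} f≗g (suc m) k = ≡.trans (≡.cong f (iter-cong f≗g m k)) (f≗g _)

iter-+ : ∀ (f : Fin n → Fin n) p q k → iter f (p ℕ.+ q) k ≡ iter f p (iter f q k)
iter-+ f zero    q k = ≡.refl
iter-+ f (suc p) q k = ≡.cong f (iter-+ f p q k)

iter-suc : ∀ (f : Fin n → Fin n) m k → iter f m (f k) ≡ iter f (suc m) k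
iter-suc f m k = ≡.trans (≡.sym (iter-+ f m 1 k)) (≡.cong (λ p → iter f p k) (ℕₚ.+-comm m 1))

iter-isInjective : ∀ {f : Fin n → Fin n} → IsInjective f → ∀ m → IsInjective (iter f m)
iter-isInjective f-inj zero    eq = eq
iter-isInjective f-inj (suc m) eq = iter-isInjective f-inj m (f-inj eq)

iter-*-return : ∀ (f : Fin n → Fin n) {L k} → iter f L k ≡ k → ∀ q → iter f (q ℕ.* L) k ≡ k
iter-*-return f ret zero = ≡.refl
iter-*-return f {L} {k} ret (suc q) =
  ≡.trans (iter-+ f L (q ℕ.* L) k) (≡.trans (≡.cong (iter f L) (iter-*-return f ret q)) ret)

-- `cycleLen` is a search with fuel, awkward to evaluate on a modified permutation. These properties
-- determine the length, so a cycle length is found by exhibiting a period.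
record IsPeriod (f : Fin n → Fin n) (k : Fin n) (L : ℕ) : Set where
  field
    positive : 0 < L
    returns  : iter f L k ≡ k
    least    : ∀ {t} → 0 < t → t < L → iter f t k ≢ k

  iter-% : ∀ m → iter f (_%_ m L {{>-nonZero positive}}) k ≡ iter f m k
  iter-% m = ≡.sym (≡.trans (≡.cong (λ p → iter f p k) (m≡m%n+[m/n]*n m L))
    (≡.trans (iter-+ f (m % L) (m / L ℕ.* L) k) (≡.cong (iter f (m % L)) (iter-*-return f returns (m / L)))))
    where instance _ = >-nonZero positive

open IsPeriod

period-unique : ∀ {f : Fin n → Fin n} {k L L′} → IsPeriod f k L → IsPeriod f k L′ → L ≡ L′
period-unique {L = L} {L′} p q with <-cmp L L′
... | tri< L<L′ _ _ = contradiction (returns p) (least q (positive p) L<L′)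
... | tri≈ _ L≡L′ _ = L≡L′
... | tri> _ _ L′<L = contradiction (returns q) (least p (positive q) L′<L)

period-step : ∀ {f : Fin n → Fin n} → IsInjective f → ∀ {k L} → IsPeriod f k L → IsPeriod f (f k) L
period-step {f = f} f-inj {k} {L} p = record
  { positive = positive p
  ; returns  = ≡.trans (iter-suc f L k) (≡.cong f (returns p))
  ; least    = λ {t} 0<t t<L eq → least p 0<t t<L (f-inj (≡.trans (≡.sym (iter-suc f t k)) eq))
  }

period-iter : ∀ {f : Fin n → Fin n} → IsInjective f → ∀ {k L} → IsPeriod f k L → ∀ m → IsPeriod f (iter f m k) L
period-iter f-inj p zero    = p
period-iter f-inj p (suc m) = period-step f-inj (period-iter f-inj p m)

-- The known return u lies in the range searched, so the default 0 for exhausted fuel is never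
-- reached. The invariant `before` makes the return that is found the first one.
firstReturn-isPeriod : ∀ (f : Fin n → Fin n) k t fuel → 0 < t → (∀ {s} → 0 < s → s < t → iter f s k ≢ k) →
  ∀ {u} → t ≤ u → u < t ℕ.+ fuel → iter f u k ≡ k → IsPeriod f k (firstReturn f k t fuel)
firstReturn-isPeriod f k t zero 0<t before {u} t≤u u<t ret =
  contradiction (≤-trans u<t (≤-trans (≤-reflexive (ℕₚ.+-identityʳ t)) t≤u)) (<-irrefl ≡.refl)
firstReturn-isPeriod f k t (suc fuel) 0<t before {u} t≤u u<t ret with T? (iter f t k ==F k)
... | yes eq with true ← iter f t k ==F k in eq′ = record
  { positive = 0<t ; returns = ==F⇒≡ _ _ (≡.subst T (≡.sym eq′) eq) ; least = before }
firstReturn-isPeriod f k t (suc fuel) 0<t before {u} t≤u u<t ret | no ≠ with iter f t k ==F k in eq′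
... | true = contradiction _ ≠
... | false = firstReturn-isPeriod f k (suc t) fuel z<s before′
    (≤∧≢⇒< t≤u (λ { ≡.refl → t-no-return ret })) (≡.subst (u <_) (ℕₚ.+-suc t fuel) u<t) ret
  where
  t-no-return : iter f t k ≢ k
  t-no-return eq = ≡.subst T eq′ (≡⇒==F eq)
  before′ : ∀ {s} → 0 < s → s < suc t → iter f s k ≢ k
  before′ {s} 0<s (s≤s s≤t) with m≤n⇒m<n∨m≡n s≤t
  ... | inj₁ s<t    = before 0<s s<t
  ... | inj₂ ≡.refl = t-no-return

-- Two of the n + 1 iterates with exponents 0 to n coincide, and injectivity cancels the smaller
-- exponent. The bound n is exactly the fuel of `cycleLen`.
return-exists : ∀ {f : Fin n → Fin n} → IsInjective f → ∀ k → ∃ λ u → 0 < u × u ≤ n × iter f u k ≡ k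
return-exists {n} {f} f-inj k with i , j , i<j , eq ← pigeonhole (n<1+n n) (λ i → iter f (toℕ i) k) =
  toℕ j ∸ toℕ i , m<n⇒0<n∸m i<j , ≤-trans (m∸n≤m (toℕ j) (toℕ i)) (≤-pred (toℕ<n j)) ,
  iter-isInjective f-inj (toℕ i) (≡.trans (≡.sym (iter-+ f (toℕ i) (toℕ j ∸ toℕ i) k))
    (≡.trans (≡.cong (λ p → iter f p k) (m+[n∸m]≡n (<⇒≤ i<j))) (≡.sym eq)))

cycleLen-isPeriod : ∀ {f : Fin n → Fin n} → IsInjective f → ∀ k → IsPeriod f k (cycleLen f k)
cycleLen-isPeriod {n} {f} f-inj k with u , 0<u , u≤n , ret ← return-exists f-inj k =
  firstReturn-isPeriod f k 1 n z<s (λ { {suc s} _ (s≤s ()) }) 0<u (s≤s u≤n) ret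

cycleLen-unique : ∀ {f : Fin n → Fin n} → IsInjective f → ∀ {k L} → IsPeriod f k L → cycleLen f k ≡ L
cycleLen-unique f-inj {k} p = period-unique (cycleLen-isPeriod f-inj k) p

firstReturn-cong : ∀ {f g : Fin n → Fin n} → f ≗ g → ∀ k t fuel → firstReturn f k t fuel ≡ firstReturn g k t fuel
firstReturn-cong f≗g k t zero       = ≡.refl
firstReturn-cong f≗g k t (suc fuel) =
  ≡.cong₂ (λ i r → if i ==F k then t else r) (iter-cong f≗g t k) (firstReturn-cong f≗g k (suc t) fuel)

cycleLen-cong : ∀ {f g : Fin n → Fin n} → f ≗ g → ∀ k → cycleLen f k ≡ cycleLen g k
cycleLen-cong {n} f≗g k = firstReturn-cong f≗g k 1 n

all-cong : ∀ {p q : A → Bool} → p ≗ q → ∀ xs → all p xs ≡ all q xs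
all-cong p≗q []       = ≡.refl
all-cong p≗q (x ∷ xs) = ≡.cong₂ _∧_ (p≗q x) (all-cong p≗q xs)

isCycleMin-cong : ∀ {f g : Fin n → Fin n} → f ≗ g → ∀ k → isCycleMin f k ≡ isCycleMin g k
isCycleMin-cong {f = f} {g} f≗g k = ≡.trans
  (all-cong (λ m → ≡.cong (λ i → toℕ k ≤ᵇ toℕ i) (iter-cong f≗g m k)) (upTo (cycleLen f k)))
  (≡.cong (λ L → all (λ m → toℕ k ≤ᵇ toℕ (iter g m k)) (upTo L)) (cycleLen-cong f≗g k))

-- Quantifying over all iterates, not over one period, keeps cycle lengths out of comparisons
-- between two permutations; `iter-%` bridges the two forms.
IsCycleMin : (Fin n → Fin n) → Fin n → Set
IsCycleMin f k = ∀ m → toℕ k ≤ toℕ (iter f m k)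

isCycleMin⁺ : ∀ {f : Fin n → Fin n} {k} → IsCycleMin f k → T (isCycleMin f k)
isCycleMin⁺ {f = f} {k} k-min = all⁺ (λ m → toℕ k ≤ᵇ toℕ (iter f m k)) (upTo (cycleLen f k)) λ {m} _ → ≤⇒≤ᵇ (k-min m)

isCycleMin-bounded : ∀ {f : Fin n → Fin n} {k L} → IsPeriod f k L →
  (∀ {m} → m < L → toℕ k ≤ toℕ (iter f m k)) → IsCycleMin f k
isCycleMin-bounded {k = k} {L} p k≤ m = ≡.subst (λ i → toℕ k ≤ toℕ i) (iter-% p m)
  (k≤ (m%n<n m L {{>-nonZero (positive p)}}))

isCycleMin⁻ : ∀ {f : Fin n → Fin n} → IsInjective f → ∀ {k} → T (isCycleMin f k) → IsCycleMin f k
isCycleMin⁻ {f = f} f-inj {k} t = isCycleMin-bounded (cycleLen-isPeriod f-inj k) λ {m} m<L →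
  ≤ᵇ⇒≤ _ _ (all⁻ (λ m → toℕ k ≤ᵇ toℕ (iter f m k)) (upTo (cycleLen f k)) t (∈-upTo⁺ m<L))

-- Descent: if some iterate is smaller than k, the search restarts from it. The bound b above the
-- current value is the termination measure.
cycleMin-exists : ∀ {f : Fin n → Fin n} → IsInjective f → ∀ k → ∃ λ m → IsCycleMin f (iter f m k)
cycleMin-exists {n} {f} f-inj k = search n k (toℕ<n k)
  where
  search : ∀ b k → toℕ k < b → ∃ λ m → IsCycleMin f (iter f m k)
  search (suc b) k (s≤s k≤b) with any? {n = cycleLen f k} (λ i → toℕ (iter f (toℕ i) k) <? toℕ k)
  ... | yes (i , <k) with m , min ← search b (iter f (toℕ i) k) (≤-trans <k k≤b) =
    m ℕ.+ toℕ i , ≡.subst (IsCycleMin f) (≡.sym (iter-+ f m (toℕ i) k)) min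
  ... | no ≮k = 0 , isCycleMin-bounded (cycleLen-isPeriod f-inj k) λ {m} m<L →
    ≮⇒≥ λ <k → ≮k (fromℕ< m<L , ≡.subst (λ t → toℕ (iter f t k) < toℕ k) (≡.sym (toℕ-fromℕ< m<L)) <k)

T-iff⇒≡ : ∀ {x y} → (T x → T y) → (T y → T x) → x ≡ y
T-iff⇒≡ {false} {false} _ _ = ≡.refl
T-iff⇒≡ {false} {true}  _ h with () ← h _
T-iff⇒≡ {true}  {false} h _ with () ← h _
T-iff⇒≡ {true}  {true}  _ _ = ≡.refl

¬T⇒≡false : ∀ {x} → ¬ T x → x ≡ false
¬T⇒≡false h = T-iff⇒≡ h (λ ())

-- How cycles change when a point is added

module FixedPoint {n} {π′ : Fin n → Fin n} (π′-inj : IsInjective π′)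
                  {π : Fin (suc n) → Fin (suc n)} (π-inj : IsInjective π)
                  (π-zero : π zero ≡ zero) (π-suc : ∀ i → π (suc i) ≡ suc (π′ i)) where

  iter-fixed-suc : ∀ m i → iter π m (suc i) ≡ suc (iter π′ m i)
  iter-fixed-suc zero    i = ≡.refl
  iter-fixed-suc (suc m) i = ≡.trans (≡.cong π (iter-fixed-suc m i)) (π-suc _)

  cycleLen-fixed-zero : cycleLen π zero ≡ 1
  cycleLen-fixed-zero = cycleLen-unique π-inj record
    { positive = z<s ; returns = π-zero ; least = λ { {suc t} _ (s≤s ()) } }

  cycleLen-fixed-suc : ∀ i → cycleLen π (suc i) ≡ cycleLen π′ i
  cycleLen-fixed-suc i = cycleLen-unique π-inj record
    { positive = positive p
    ; returns  = ≡.trans (iter-fixed-suc (cycleLen π′ i) i) (≡.cong suc (returns p))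
    ; least    = λ {t} 0<t t<L eq → least p 0<t t<L
        (suc-injective (≡.trans (≡.sym (iter-fixed-suc t i)) eq))
    }
    where
    p = cycleLen-isPeriod π′-inj i

  isCycleMin-fixed-suc : ∀ i → isCycleMin π (suc i) ≡ isCycleMin π′ i
  isCycleMin-fixed-suc i = T-iff⇒≡
    (λ t → isCycleMin⁺ λ m → ≤-pred (≡.subst (λ j → suc (toℕ i) ≤ toℕ j) (iter-fixed-suc m i) (isCycleMin⁻ π-inj t m)))
    (λ t → isCycleMin⁺ λ m → ≡.subst (λ j → suc (toℕ i) ≤ toℕ j) (≡.sym (iter-fixed-suc m i)) (s≤s (isCycleMin⁻ π′-inj t m)))

-- The new point `suc y` is placed between `zero` and the old successor of `zero`. The map `e`
-- renumbers the old points around it and fixes `zero`; away from `zero` it carries π′ to π.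
module Splice {n} (y : Fin (suc n)) {π′ : Fin (suc n) → Fin (suc n)} (π′-inj : IsInjective π′)
              {π : Fin (suc (suc n)) → Fin (suc (suc n))} (π-inj : IsInjective π)
              (π-zero : π zero ≡ suc y) (π-new : π (suc y) ≡ punchIn (suc y) (π′ zero))
              (π-old : ∀ i → π (punchIn (suc y) (suc i)) ≡ punchIn (suc y) (π′ (suc i))) where

  private
    e : Fin (suc n) → Fin (suc (suc n))
    e = punchIn (suc y)

    π-e : ∀ {i} → i ≢ zero → π (e i) ≡ e (π′ i)
    π-e {zero}  i≢0 = contradiction ≡.refl i≢0
    π-e {suc i} _   = π-old i

  iter-avoiding : ∀ m {i} → (∀ t → iter π′ t i ≢ zero) → iter π m (e i) ≡ e (iter π′ m i)
  iter-avoiding zero    avoid = ≡.refl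
  iter-avoiding (suc m) avoid = ≡.trans (≡.cong π (iter-avoiding m avoid)) (π-e (avoid m))

  -- The visit to the new point costs one step, hence 2 + t against 1 + t. The bound t < L keeps the
  -- intermediate iterates away from `zero`, where π and π′ differ.
  iter-zero : ∀ {L} → IsPeriod π′ zero L → ∀ t → t < L → iter π (2 ℕ.+ t) zero ≡ e (iter π′ (1 ℕ.+ t) zero)
  iter-zero p zero    t<L = ≡.trans (≡.cong π π-zero) π-new
  iter-zero p (suc t) t<L = ≡.trans (≡.cong π (iter-zero p t (<⇒≤ t<L))) (π-e (least p z<s t<L))

  zero-period : ∀ {L} → IsPeriod π′ zero L → IsPeriod π zero (suc L)
  zero-period {zero}  p with () ← positive p
  zero-period {suc L} p = record
    { positive = z<s
    ; returns  = ≡.trans (iter-zero p L ≤-refl) (≡.cong e (returns p))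
    ; least    = no-return
    }
    where
    no-return : ∀ {t} → 0 < t → t < 2 ℕ.+ L → iter π t zero ≢ zero
    no-return {1} _ _ eq with () ← ≡.trans (≡.sym π-zero) eq
    no-return {suc (suc t)} _ (s≤s t<L) eq = least p z<s t<L
      (punchIn-injective (suc y) _ zero (≡.trans (≡.sym (iter-zero p t (<⇒≤ t<L))) eq))

  cycleLen-splice-zero : cycleLen π zero ≡ suc (cycleLen π′ zero)
  cycleLen-splice-zero = cycleLen-unique π-inj (zero-period (cycleLen-isPeriod π′-inj zero))

  isCycleMin-splice-new : isCycleMin π (suc y) ≡ false
  isCycleMin-splice-new = ¬T⇒≡false λ t → contradiction (isCycleMin⁻ π-inj t L) (not-≤ reaches-zero)
    where
    -- The cycle of `zero` under π has length L + 1 and the new point is one step after `zero`, so L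
    -- steps lead back.
    L = cycleLen π′ zero
    not-≤ : ∀ {k} → k ≡ zero → ¬ (suc (toℕ y) ≤ toℕ k)
    not-≤ ≡.refl ()
    reaches-zero : iter π L (suc y) ≡ zero
    reaches-zero = ≡.trans (≡.cong (iter π L) (≡.sym π-zero)) (≡.trans (iter-suc π L zero)
      (returns (zero-period (cycleLen-isPeriod π′-inj zero))))

  private
    cycleMin-avoids-zero : ∀ {i} → IsCycleMin π′ (suc i) → ∀ t → iter π′ t (suc i) ≢ zero
    cycleMin-avoids-zero i-min t eq with () ← ≡.subst (λ k → suc _ ≤ toℕ k) eq (i-min t)

    -- Each passage through `zero` costs one extra step, so the exponent m′ depends on the orbit and
    -- only its existence is claimed.
    reaches : ∀ m i → ∃ λ m′ → iter π m′ (e i) ≡ e (iter π′ m i)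
    reaches zero    i = 0 , ≡.refl
    reaches (suc m) i with m′ , eq ← reaches m i with iter π′ m i
    ... | zero  = 2 ℕ.+ m′ , ≡.trans (≡.cong (π ∘ π) eq) (≡.trans (≡.cong π π-zero) π-new)
    ... | suc j = 1 ℕ.+ m′ , ≡.trans (≡.cong π eq) (π-old j)

  -- As `punchIn` preserves order, only the orbits matter. Every old iterate is still visited by π;
  -- conversely, a nonzero minimum has a cycle avoiding `zero`, which the splice leaves intact.
  isCycleMin-splice-old : ∀ i → isCycleMin π (punchIn (suc y) (suc i)) ≡ isCycleMin π′ (suc i)
  isCycleMin-splice-old i = T-iff⇒≡
    (λ t → isCycleMin⁺ λ m → let m′ , eq = reaches m (suc i) in punchIn-cancel-≤ (suc y) (suc i) _
      (≡.subst (λ j → toℕ (e (suc i)) ≤ toℕ j) eq (isCycleMin⁻ π-inj t m′)))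
    (λ t → let i-min = isCycleMin⁻ π′-inj t in isCycleMin⁺ λ m →
      ≡.subst (λ j → toℕ (e (suc i)) ≤ toℕ j) (≡.sym (iter-avoiding m (cycleMin-avoids-zero i-min)))
        (punchIn-mono-≤ (suc y) (suc i) _ (i-min m)))

  -- Restricted to minima because a nonzero point on the cycle of `zero` gets a longer cycle; being
  -- no minimum, it contributes a neutral factor anyway.
  cycleLen-splice-old : ∀ i → T (isCycleMin π′ (suc i)) → cycleLen π (punchIn (suc y) (suc i)) ≡ cycleLen π′ (suc i)
  cycleLen-splice-old i t = cycleLen-unique π-inj record
    { positive = positive p
    ; returns  = ≡.trans (iter-avoiding (cycleLen π′ (suc i)) avoid) (≡.cong e (returns p))
    ; least    = λ {t} 0<t t<L eq → least p 0<t t<L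
        (punchIn-injective (suc y) _ _ (≡.trans (≡.sym (iter-avoiding t avoid)) eq))
    }
    where
    p = cycleLen-isPeriod π′-inj (suc i)
    avoid = cycleMin-avoids-zero (isCycleMin⁻ π′-inj t)

-- Weights of permutations, one factor per cycle

module Weights {c ℓ} (M : CommutativeMonoid c ℓ) (y : ℕ → CommutativeMonoid.Carrier M) where
  open CommutativeMonoid M
  open Fold M

  factor : (Fin n → Fin n) → Fin n → Carrier
  factor π k = if isCycleMin π k then y (cycleLen π k) else ε

  cycleWeight : (Fin n → Fin n) → Carrier
  cycleWeight π = sum (factor π)

  -- The cycle through zero is weighted as if it had s additional elements.
  rootedWeight : ℕ → (Fin (suc n) → Fin (suc n)) → Carrier
  rootedWeight s π = y (cycleLen π zero ℕ.+ s) ∙ sum (factor π ∘ suc)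

  factor-cong : ∀ {f g : Fin n → Fin n} → f ≗ g → ∀ k → factor f k ≈ factor g k
  factor-cong f≗g k = reflexive (≡.cong₂ (λ b L → if b then y L else ε) (isCycleMin-cong f≗g k) (cycleLen-cong f≗g k))

  rootedWeight-cong : ∀ s {f g : Fin (suc n) → Fin (suc n)} → f ≗ g → rootedWeight s f ≈ rootedWeight s g
  rootedWeight-cong s f≗g = ∙-cong (reflexive (≡.cong (λ L → y (L ℕ.+ s)) (cycleLen-cong f≗g zero)))
    (sum-cong-≋ (factor-cong f≗g ∘ suc))

  -- `zero` is the minimum of its cycle, so its factor is never the neutral default.
  cycleWeight≈rootedWeight : ∀ (π : Fin (suc n) → Fin (suc n)) → cycleWeight π ≈ rootedWeight 0 π
  cycleWeight≈rootedWeight π = ∙-congʳ (reflexive (≡.cong₂ (λ b L → if b then y L else ε)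
    (T-iff⇒≡ {y = true} _ (λ _ → isCycleMin⁺ {f = π} {k = zero} (λ _ → z≤n)))
    (≡.sym (ℕₚ.+-identityʳ (cycleLen π zero)))))

  rootedWeight-fixed : ∀ s {ρ : Fin n → Fin n} → IsInjective ρ →
    rootedWeight s (insert zero zero ρ) ≈ y (suc s) ∙ cycleWeight ρ
  rootedWeight-fixed s {ρ} ρ-inj = ∙-cong
    (reflexive (≡.cong (λ L → y (L ℕ.+ s)) cycleLen-fixed-zero))
    (sum-cong-≋ λ i → reflexive (≡.cong₂ (λ b L → if b then y L else ε)
      (isCycleMin-fixed-suc i) (cycleLen-fixed-suc i)))
    where open FixedPoint ρ-inj (insert-isInjective zero zero ρ-inj) ≡.refl (λ _ → ≡.refl)

  -- Precomposition with insert z zero id turns insertion in one-line notation into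
  -- the insertion of suc z behind zero in its cycle.
  rootedWeight-splice : ∀ s (z : Fin (suc n)) {ρ : Fin (suc n) → Fin (suc n)} → IsInjective ρ →
    rootedWeight s (insert zero (suc z) (ρ ∘ insert z zero id)) ≈ rootedWeight (suc s) ρ
  rootedWeight-splice s z {ρ} ρ-inj = ∙-cong
    -- The added element of the cycle is traded for one more unit of shift.
    (reflexive (≡.cong y (≡.trans (≡.cong (ℕ._+ s) cycleLen-splice-zero) (≡.sym (ℕₚ.+-suc (cycleLen ρ zero) s)))))
    (trans (sum-remove {i = z} (factor π ∘ suc))
      (trans (∙-cong (reflexive (≡.cong (λ b → if b then y (cycleLen π (suc z)) else ε) isCycleMin-splice-new))
               (sum-cong-≋ λ i → old i))
        (identityˡ _)))
    where
    π = insert zero (suc z) (ρ ∘ insert z zero id)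
    open Splice z ρ-inj {π}
      (insert-isInjective zero (suc z) (insert-isInjective z zero id ∘ ρ-inj))
      ≡.refl
      (≡.cong (punchIn (suc z) ∘ ρ) (insert-at z zero id))
      (λ i → ≡.cong (punchIn (suc z) ∘ ρ) (insert-punchIn z zero id i))
    old : ∀ i → factor π (suc (punchIn z i)) ≈ factor ρ (suc i)
    old i with isCycleMin ρ (suc i) in eq
    ... | true = reflexive (≡.cong₂ (λ b L → if b then y L else ε)
                   (≡.trans (isCycleMin-splice-old i) eq) (cycleLen-splice-old i (≡.subst T (≡.sym eq) _)))
    ... | false = reflexive (≡.cong (λ b → if b then y (cycleLen π (suc (punchIn z i))) else ε)
                   (≡.trans (isCycleMin-splice-old i) eq))

-- Inversions and determinants

≡ᵇ-refl : ∀ m → (m ≡ᵇ m) ≡ true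
≡ᵇ-refl m = T-iff⇒≡ _ (λ _ → ≡⇒≡ᵇ m m ≡.refl)

≢⇒≡ᵇ-false : ∀ {m k} → m ≢ k → (m ≡ᵇ k) ≡ false
≢⇒≡ᵇ-false m≢k = ¬T⇒≡false (m≢k ∘ ≡ᵇ⇒≡ _ _)

toℕ-punchIn-< : ∀ (x : Fin (suc n)) j → toℕ j < toℕ x → toℕ (punchIn x j) ≡ toℕ j
toℕ-punchIn-< (suc x) zero    _         = ≡.refl
toℕ-punchIn-< (suc x) (suc j) (s<s j<x) = ≡.cong suc (toℕ-punchIn-< x j j<x)

toℕ-punchIn-≥ : ∀ (x : Fin (suc n)) j → toℕ x ≤ toℕ j → toℕ (punchIn x j) ≡ suc (toℕ j)
toℕ-punchIn-≥ zero    j       _         = ≡.refl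
toℕ-punchIn-≥ (suc x) (suc j) (s≤s x≤j) = ≡.cong suc (toℕ-punchIn-≥ x j x≤j)

toℕ<fromℕ : ∀ (j : Fin n) → toℕ j < toℕ (fromℕ n)
toℕ<fromℕ {n} j = ≡.subst (toℕ j <_) (≡.sym (toℕ-fromℕ n)) (toℕ<n j)

toℕ-punchIn-fromℕ : ∀ (j : Fin n) → toℕ (punchIn (fromℕ n) j) ≡ toℕ j
toℕ-punchIn-fromℕ {n} j = toℕ-punchIn-< (fromℕ n) j (toℕ<fromℕ j)

<ᵇ-punchIn : ∀ (x : Fin (suc n)) j → (toℕ x <ᵇ toℕ (punchIn x j)) ≡ (toℕ x ≤ᵇ toℕ j)
<ᵇ-punchIn zero    j       = ≡.refl
<ᵇ-punchIn (suc x) zero    = ≡.refl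
<ᵇ-punchIn (suc x) (suc j) = ≡.trans (<ᵇ-punchIn x j) (≤ᵇ≡<ᵇsuc (toℕ x))
  where
  ≤ᵇ≡<ᵇsuc : ∀ m {k} → (m ≤ᵇ k) ≡ (m <ᵇ suc k)
  ≤ᵇ≡<ᵇsuc zero    = ≡.refl
  ≤ᵇ≡<ᵇsuc (suc m) = ≡.refl

punchIn-<ᵇ : ∀ (x : Fin (suc n)) i j → (toℕ (punchIn x i) <ᵇ toℕ (punchIn x j)) ≡ (toℕ i <ᵇ toℕ j)
punchIn-<ᵇ zero    i       j       = ≡.refl
punchIn-<ᵇ (suc x) zero    zero    = ≡.refl
punchIn-<ᵇ (suc x) zero    (suc j) = ≡.refl
punchIn-<ᵇ (suc x) (suc i) zero    = ≡.refl
punchIn-<ᵇ (suc x) (suc i) (suc j) = punchIn-<ᵇ x i j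

private
  module ℕ∑ = Fold ℕₚ.+-0-commutativeMonoid

indicator : Bool → ℕ
indicator b = if b then 1 else 0

count≡sum : ∀ (p : Fin n → Bool) → count p (allFin n) ≡ ℕ∑.sum (indicator ∘ p)
count≡sum {n} p = ≡.trans (count≡fold (allFin n)) (ℕ∑.fold-tabulate {n = n} id (indicator ∘ p))
  where
  count≡fold : ∀ xs → count p xs ≡ ℕ∑.fold xs (indicator ∘ p)
  count≡fold []       = ≡.refl
  count≡fold (x ∷ xs) with p x
  ... | true  = ≡.cong suc (count≡fold xs)
  ... | false = count≡fold xs

isInversion : (Fin n → Fin n) → Fin n → Fin n → Bool
isInversion f i j = (toℕ i <ᵇ toℕ j) ∧ (toℕ (f j) <ᵇ toℕ (f i))

inversions≡sum : ∀ (f : Fin n → Fin n) →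
  inversions f ≡ ℕ∑.sum (λ i → ℕ∑.sum (λ j → indicator (isInversion f i j)))
inversions≡sum {n} f = ≡.trans (sumℕ-map (allFin n))
  (≡.trans (ℕ∑.fold-tabulate {n = n} id (λ i → count (isInversion f i) (allFin n)))
    (ℕ∑.sum-cong-≋ (λ i → count≡sum (isInversion f i))))
  where
  sumℕ-map : ∀ {g : Fin n → ℕ} xs → sumℕ (map g xs) ≡ ℕ∑.fold xs g
  sumℕ-map []       = ≡.refl
  sumℕ-map {g} (x ∷ xs) = ≡.cong (g x ℕ.+_) (sumℕ-map xs)

inversions-cong : ∀ {f g : Fin n → Fin n} → f ≗ g → inversions f ≡ inversions g
inversions-cong {f = f} {g} f≗g = ≡.trans (inversions≡sum f) (≡.trans
  (ℕ∑.sum-cong-≋ λ i → ℕ∑.sum-cong-≋ λ j →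
    ≡.cong₂ (λ fi fj → indicator ((toℕ i <ᵇ toℕ j) ∧ (toℕ fj <ᵇ toℕ fi))) (f≗g i) (f≗g j))
  (≡.sym (inversions≡sum g)))

-- This is n - `toℕ x`, the number of values above x: the exponent of the cofactor sign for column x
-- of the last row. As a sum it can be reindexed along ρ.
countFrom : ∀ {n} → Fin (suc n) → ℕ
countFrom {n} x = ℕ∑.sum {n} (λ i → indicator (toℕ x ≤ᵇ toℕ i))

countFrom-last : ∀ n → countFrom (fromℕ n) ≡ 0
countFrom-last n = ℕ∑.sum-ε {n = n} λ i →
  ≡.cong indicator (¬T⇒≡false (<⇒≱ (toℕ<fromℕ i) ∘ ≤ᵇ⇒≤ (toℕ (fromℕ n)) (toℕ i)))

countFrom-penultimate : ∀ n → countFrom (punchIn (fromℕ (suc n)) (fromℕ n)) ≡ 1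
countFrom-penultimate n = ≡.trans
  (ℕ∑.sum-cong-≋ {suc n} λ i → ≡.cong (λ x → indicator (x ≤ᵇ toℕ i)) (toℕ-punchIn-fromℕ (fromℕ n)))
  (≡.trans
    (ℕ∑.sum-only {n = n} (fromℕ n) {λ i → indicator (toℕ (fromℕ n) ≤ᵇ toℕ i)} λ j →
      ≡.cong indicator (¬T⇒≡false λ t →
        <⇒≱ (toℕ<fromℕ j) (≡.subst (toℕ (fromℕ n) ≤_) (toℕ-punchIn-fromℕ j) (≤ᵇ⇒≤ _ _ t))))
    (≡.cong indicator (T-iff⇒≡ {y = true} _ λ _ → ≤⇒≤ᵇ {toℕ (fromℕ n)} ≤-refl)))

-- A pair involving the last position is inverted exactly when its other value exceeds x, and ρ
-- being a bijection, the number of such values is `countFrom x`. The remaining pairs keep their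
-- order and give the inversions of ρ.
inversions-insert-last : ∀ (x : Fin (suc n)) {ρ} → IsInjective ρ →
  inversions (insert (fromℕ n) x ρ) ≡ countFrom x ℕ.+ inversions ρ
inversions-insert-last {n} x {ρ} ρ-inj = begin
  inversions f
    ≡⟨ inversions≡sum f ⟩
  ℕ∑.sum (λ i → ℕ∑.sum (h i))
    ≡⟨ ℕ∑.sum-remove {i = r} (λ i → ℕ∑.sum (h i)) ⟩
  ℕ∑.sum (h r) ℕ.+ ℕ∑.sum (λ i → ℕ∑.sum (h (punchIn r i)))
    ≡⟨ ≡.cong₂ ℕ._+_ (ℕ∑.sum-ε row-last) (ℕ∑.sum-cong-≋ row) ⟩
  ℕ∑.sum (λ i → indicator (toℕ x ≤ᵇ toℕ (ρ i)) ℕ.+ ℕ∑.sum (λ j → indicator (isInversion ρ i j)))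
    ≡⟨ ℕ∑.∑-distrib-+ (λ i → indicator (toℕ x ≤ᵇ toℕ (ρ i))) _ ⟩
  ℕ∑.sum (λ i → indicator (toℕ x ≤ᵇ toℕ (ρ i))) ℕ.+ ℕ∑.sum (λ i → ℕ∑.sum (λ j → indicator (isInversion ρ i j)))
    ≡⟨ ≡.cong₂ ℕ._+_ (sum-reindex ℕₚ.+-0-commutativeMonoid ρ-inj (λ i → indicator (toℕ x ≤ᵇ toℕ i)))
                     (≡.sym (inversions≡sum ρ)) ⟩
  countFrom x ℕ.+ inversions ρ ∎
  where
  open ≡.≡-Reasoning
  r = fromℕ n
  f = insert r x ρ
  h : Fin (suc n) → Fin (suc n) → ℕ
  h i j = indicator (isInversion f i j)

  row-last : ∀ j → h r j ≡ 0
  row-last j = ≡.cong (λ b → indicator (b ∧ (toℕ (f j) <ᵇ toℕ (f r))))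
    (¬T⇒≡false λ t → <⇒≱ (<ᵇ⇒< _ _ t) (≡.subst (toℕ j ≤_) (≡.sym (toℕ-fromℕ n)) (≤-pred (toℕ<n j))))

  i<r : ∀ (i : Fin n) → (toℕ (punchIn r i) <ᵇ toℕ r) ≡ true
  i<r i = T-iff⇒≡ {y = true} _ λ _ → <⇒<ᵇ (≡.subst (_< toℕ r) (≡.sym (toℕ-punchIn-fromℕ i)) (toℕ<fromℕ i))

  row : ∀ i → ℕ∑.sum (h (punchIn r i)) ≡
              indicator (toℕ x ≤ᵇ toℕ (ρ i)) ℕ.+ ℕ∑.sum (λ j → indicator (isInversion ρ i j))
  row i = ≡.trans (ℕ∑.sum-remove {i = r} (h (punchIn r i))) (≡.cong₂ ℕ._+_
    (≡.cong indicator (≡.cong₂ _∧_ (i<r i)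
      (≡.trans (≡.cong₂ (λ k l → toℕ k <ᵇ toℕ l) (insert-at r x ρ) (insert-punchIn r x ρ i)) (<ᵇ-punchIn x (ρ i)))))
    (ℕ∑.sum-cong-≋ λ j → ≡.cong indicator (≡.cong₂ _∧_
      (≡.cong₂ _<ᵇ_ (toℕ-punchIn-fromℕ i) (toℕ-punchIn-fromℕ j))
      (≡.trans (≡.cong₂ (λ k l → toℕ k <ᵇ toℕ l) (insert-punchIn r x ρ j) (insert-punchIn r x ρ i))
               (punchIn-<ᵇ x (ρ j) (ρ i))))))

-- Determinant expansion and the recursion common to both sides

module RingSums {c ℓ} (R : CommutativeRing c ℓ) where
  open CommutativeRing R hiding (zero)
  open import Relation.Binary.Reasoning.Setoid setoid
  open import Algebra.Properties.CommutativeSemigroup *-commutativeSemigroup using (x∙yz≈y∙xz)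
  module ∑ = Fold +-commutativeMonoid
  -- The additive names persist for this monoid: `∏.sum` and `∏.fold` are products.
  module ∏ = Fold *-commutativeMonoid

  fold-*ˡ : ∀ x (xs : List A) g → ∑.fold xs (λ i → x * g i) ≈ x * ∑.fold xs g
  fold-*ˡ x []       g = sym (zeroʳ x)
  fold-*ˡ x (i ∷ xs) g = trans (+-congˡ (fold-*ˡ x xs g)) (sym (distribˡ x _ _))

  sum-const : ∀ n x → ∑.sum {n} (λ _ → x) ≈ ofℕ R n * x
  sum-const zero    x = sym (zeroˡ x)
  sum-const (suc n) x = trans (+-cong (sym (*-identityˡ x)) (sum-const n x)) (sym (distribʳ x 1# (ofℕ R n)))

  pow-+ : ∀ x p q → pow R x (p ℕ.+ q) ≈ pow R x p * pow R x q
  pow-+ x zero    q = sym (*-identityˡ _)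
  pow-+ x (suc p) q = trans (*-congˡ (pow-+ x p q)) (sym (*-assoc _ _ _))

  detTerm : (Fin n → Fin n → Carrier) → (Fin n → Fin n) → Carrier
  detTerm {n} B σ = pow R (- 1#) (inversions σ) * ∏ R (allFin n) (λ k → B k (σ k))

  ∏-allFin : ∀ (g : Fin n → Carrier) → ∏ R (allFin n) g ≈ ∏.sum g
  ∏-allFin {n} g = ∏.fold-tabulate {n = n} id g

  detTerm-cong : ∀ (B : Fin n → Fin n → Carrier) {f g} → f ≗ g → detTerm B f ≈ detTerm B g
  detTerm-cong {n} B f≗g = *-cong (reflexive (≡.cong (pow R (- 1#)) (inversions-cong f≗g)))
    (∏.fold-cong′ (allFin n) (λ k → reflexive (≡.cong (B k) (f≗g k))))

  det-cong : ∀ {B B′ : Fin n → Fin n → Carrier} → (∀ i j → B i j ≈ B′ i j) → det R n B ≈ det R n B′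
  det-cong {n} e = ∑.fold-cong′ (perms n) λ σ → *-congˡ (∏.fold-cong′ (allFin n) λ k → e k (σ k))

  -- A permutation meets each column once, so every term yields the same product of scalars.
  det-scale-columns : ∀ (x : Fin n → Carrier) B → det R n (λ i j → x j * B i j) ≈ ∏.sum x * det R n B
  det-scale-columns {n} x B = trans
    (∑.fold-cong (All.map scale (perms-isInjective n)))
    (fold-*ˡ (∏.sum x) (perms n) (detTerm B))
    where
    scale : ∀ {σ} → IsInjective σ → detTerm (λ i j → x j * B i j) σ ≈ ∏.sum x * detTerm B σ
    scale {σ} σ-inj = begin
      s * ∏ R (allFin n) (λ k → x (σ k) * B k (σ k))  ≈⟨ *-congˡ (∏-allFin {n} _) ⟩
      s * ∏.sum (λ k → x (σ k) * B k (σ k))           ≈⟨ *-congˡ (∏.∑-distrib-+ (x ∘ σ) _) ⟩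
      s * (∏.sum (x ∘ σ) * ∏.sum (λ k → B k (σ k)))   ≈⟨ *-congˡ (*-cong (sum-reindex *-commutativeMonoid σ-inj x) (sym (∏-allFin {n} _))) ⟩
      s * (∏.sum x * ∏ R (allFin n) (λ k → B k (σ k))) ≈⟨ x∙yz≈y∙xz _ _ _ ⟩
      ∏.sum x * detTerm B σ ∎
      where s = pow R (- 1#) (inversions σ)

  lastRowMinor : (Fin (suc n) → Fin (suc n) → Carrier) → Fin (suc n) → Fin n → Fin n → Carrier
  lastRowMinor {n} B x i j = B (punchIn (fromℕ n) i) (punchIn x j)

  det-last-row : ∀ (B : Fin (suc n) → Fin (suc n) → Carrier) →
    det R (suc n) B ≈ ∑.sum (λ x → B (fromℕ n) x * (pow R (- 1#) (countFrom x) * det R n (lastRowMinor B x)))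
  det-last-row {n} B = trans
    (fold-perms-insert +-commutativeMonoid r (detTerm-cong B))
    (∑.sum-cong-≋ λ x → trans
      (∑.fold-cong (All.map (expand x) (perms-isInjective n)))
      (trans (fold-*ˡ _ (perms n) _) (*-congˡ (fold-*ˡ _ (perms n) _))))
    where
    r = fromℕ n
    expand : ∀ x {ρ} → IsInjective ρ →
      detTerm B (insert r x ρ) ≈ B r x * (pow R (- 1#) (countFrom x) * detTerm (lastRowMinor B x) ρ)
    expand x {ρ} ρ-inj = begin
      pow R (- 1#) (inversions f) * ∏ R (allFin (suc n)) (λ k → B k (f k))
        ≈⟨ *-cong (trans (reflexive (≡.cong (pow R (- 1#)) (inversions-insert-last x ρ-inj))) (pow-+ _ (countFrom x) (inversions ρ)))
                  (trans (∏-allFin (λ k → B k (f k))) (∏.sum-remove {i = r} (λ k → B k (f k)))) ⟩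
      (p * q) * (B r (f r) * ∏.sum (λ i → B (punchIn r i) (f (punchIn r i))))
        ≈⟨ *-congˡ (*-cong (reflexive (≡.cong (B r) (insert-at r x ρ)))
             (trans (∏.sum-cong-≋ λ i → reflexive (≡.cong (B (punchIn r i)) (insert-punchIn r x ρ i)))
                    (sym (∏-allFin {n} _)))) ⟩
      (p * q) * (B r x * m)  ≈⟨ x∙yz≈y∙xz _ _ _ ⟩
      B r x * ((p * q) * m)  ≈⟨ *-congˡ (*-assoc p q m) ⟩
      B r x * (p * (q * m)) ∎
      where
      f = insert r x ρ
      p = pow R (- 1#) (countFrom x)
      q = pow R (- 1#) (inversions ρ)
      m = ∏ R (allFin n) (λ i → lastRowMinor B x i (ρ i))

  module _ (y : ℕ → Carrier) where
    open Weights *-commutativeMonoid y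

    record Recursion (D : ℕ → Carrier) (E : ℕ → ℕ → Carrier) : Set ℓ where
      field
        D-zero : D 0 ≈ 1#
        D-suc  : ∀ n → D (suc n) ≈ E 0 n
        -- At n = 0 the second summand has coefficient 0.
        E-zero : ∀ s → E s 0 ≈ y (suc s) * D 0
        E-suc  : ∀ s n → E s (suc n) ≈ y (suc s) * D (suc n) + ofℕ R (suc n) * E (suc s) n

    open Recursion

    -- Induction on n with s arbitrary, since `E s` at n + 1 refers to `E (suc s)` at n.
    recursion-unique : ∀ {D E D′ E′} → Recursion D E → Recursion D′ E′ → ∀ n → D n ≈ D′ n
    recursion-unique {D} {E} {D′} {E′} p q = D≈
      where
      D≈ : ∀ n → D n ≈ D′ n
      E≈ : ∀ s n → E s n ≈ E′ s n
      D≈ zero    = trans (D-zero p) (sym (D-zero q))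
      D≈ (suc n) = trans (D-suc p n) (trans (E≈ 0 n) (sym (D-suc q n)))
      E≈ s zero    = trans (E-zero p s) (trans (*-congˡ (D≈ zero)) (sym (E-zero q s)))
      E≈ s (suc n) = trans (E-suc p s n)
        (trans (+-cong (*-congˡ (trans (D-suc p n) (trans (E≈ 0 n) (sym (D-suc q n))))) (*-congˡ (E≈ (suc s) n))) (sym (E-suc q s n)))

    permSum : ℕ → Carrier
    permSum n = ∑.fold (perms n) cycleWeight

    rootedSum : ℕ → ℕ → Carrier
    rootedSum s n = ∑.fold (perms (suc n)) (rootedWeight s)

    rootedSum-insert : ∀ s n → rootedSum s n ≈
      y (suc s) * permSum n + ∑.sum {n} (λ x → ∑.fold (perms n) (λ ρ → rootedWeight s (insert zero (suc x) ρ)))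
    rootedSum-insert s n = trans
      (fold-perms-insert +-commutativeMonoid {n = n} zero (rootedWeight-cong s))
      (+-congʳ (trans (∑.fold-cong (All.map (rootedWeight-fixed s) (perms-isInjective n)))
                      (fold-*ˡ (y (suc s)) (perms n) cycleWeight)))

    cycle-recursion : Recursion permSum rootedSum
    cycle-recursion = record
      { D-zero = +-identityʳ 1#
      ; D-suc  = λ n → ∑.fold-cong′ (perms (suc n)) cycleWeight≈rootedWeight
      ; E-zero = λ s → trans (rootedSum-insert s 0) (+-identityʳ _)
      ; E-suc  = λ s n → trans (rootedSum-insert s (suc n))
          -- All n + 1 possible successors of `zero` contribute equally.
          (+-congˡ (trans (∑.sum-cong-≋ (splice s n)) (sum-const (suc n) _)))
      }
      where
      splice : ∀ s n x → ∑.fold (perms (suc n)) (λ ρ → rootedWeight s (insert zero (suc x) ρ)) ≈ rootedSum (suc s) n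
      splice s n x = trans
        -- The relabelling g sends x to `zero` and keeps the order of the other points, so the
        -- position of the new point takes over the old value at `zero`.
        (fold-perms-∘ +-commutativeMonoid {g = insert x zero id} {h = insert zero x id} inverse₁ inverse₂
          (λ f≗g → rootedWeight-cong s (insert-cong zero {suc x} ≡.refl f≗g)))
        (∑.fold-cong (All.map (rootedWeight-splice s x) (perms-isInjective (suc n))))
        where
        inverse : ∀ (r z : Fin (suc n)) → insert r z id ∘ insert z r id ≗ id
        inverse r z k with punchIn-view z k
        ... | inj₁ ≡.refl = ≡.trans (≡.cong (insert r z id) (insert-at z r id)) (insert-at r z id)
        ... | inj₂ (j , ≡.refl) = ≡.trans (≡.cong (insert r z id) (insert-punchIn z r id j)) (insert-punchIn r z id j)
        inverse₁ = inverse x zero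
        inverse₂ = inverse zero x

-- The Hessenberg matrix and the cycle sum

module Hessenberg {c ℓ} (R : CommutativeRing c ℓ) (ι : CommutativeRing.Carrier R)
  (ι² : CommutativeRing._≈_ R (CommutativeRing._*_ R ι ι) (CommutativeRing.-_ R (CommutativeRing.1# R)))
  (y : ℕ → CommutativeRing.Carrier R) where
  open CommutativeRing R hiding (zero)
  open RingSums R
  open import Algebra.Properties.Ring ring using (-1*x≈-x; -‿involutive)
  open import Algebra.Solver.CommutativeMonoid *-commutativeMonoid using (solve; _⊕_; _⊜_) renaming (id to unit)
  open import Relation.Binary.Reasoning.Setoid setoid

  -- Indices are natural numbers so that minors are compared by rewriting `toℕ` of a `punchIn`. The
  -- shift s affects only the index of y, not the subdiagonal.
  entry : ℕ → ℕ → ℕ → Carrier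
  entry s k j with k ≤? j
  ... | yes _ = pow R ι (j ∸ k) * y (suc (j ∸ k ℕ.+ s))
  ... | no _  = if k ≡ᵇ suc j then ι * ofℕ R (suc j) else 0#

  entry-≤ : ∀ s {k j} → k ≤ j → entry s k j ≡ pow R ι (j ∸ k) * y (suc (j ∸ k ℕ.+ s))
  entry-≤ s {k} {j} k≤j with k ≤? j
  ... | yes _  = ≡.refl
  ... | no k≰j = contradiction k≤j k≰j

  entry-subdiagonal : ∀ s j → entry s (suc j) j ≡ ι * ofℕ R (suc j)
  entry-subdiagonal s j with suc j ≤? j
  ... | yes j<j = contradiction j<j (<-irrefl ≡.refl)
  ... | no _ rewrite ≡ᵇ-refl j = ≡.refl

  entry-low : ∀ s {k j} → suc j < k → entry s k j ≡ 0#
  entry-low s {k} {j} j+1<k with k ≤? j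
  ... | yes k≤j = contradiction (<⇒≤ j+1<k) (λ j<k → <⇒≱ j<k k≤j)
  ... | no _ rewrite ≢⇒≡ᵇ-false (λ k≡ → <⇒≢ j+1<k (≡.sym k≡)) = ≡.refl

  -- One column to the right, j - k grows by one: one more ι and one more in the index of y. This is
  -- how a minor with a skipped column becomes a shifted matrix.
  entry-extend-column : ∀ s {k j} → k ≤ j → entry s k (suc j) ≈ ι * entry (suc s) k j
  entry-extend-column s {k} {j} k≤j = begin
    entry s k (suc j)                                          ≡⟨ entry-≤ s (ℕₚ.m≤n⇒m≤1+n k≤j) ⟩
    pow R ι (suc j ∸ k) * y (suc (suc j ∸ k ℕ.+ s))            ≡⟨ ≡.cong (λ d → pow R ι d * y (suc (d ℕ.+ s))) (ℕₚ.+-∸-assoc 1 k≤j) ⟩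
    ι * pow R ι (j ∸ k) * y (suc (suc (j ∸ k) ℕ.+ s))          ≡⟨ ≡.cong (λ d → ι * pow R ι (j ∸ k) * y (suc d)) (≡.sym (ℕₚ.+-suc (j ∸ k) s)) ⟩
    ι * pow R ι (j ∸ k) * y (suc (j ∸ k ℕ.+ suc s))            ≈⟨ *-assoc _ _ _ ⟩
    ι * (pow R ι (j ∸ k) * y (suc (j ∸ k ℕ.+ suc s)))          ≡⟨ ≡.cong (ι *_) (≡.sym (entry-≤ (suc s) k≤j)) ⟩
    ι * entry (suc s) k j                                      ∎

  matrix : ∀ n → Fin n → Fin n → Carrier
  matrix n k j = entry 0 (toℕ k) (toℕ j)

  lastColumnShift : ℕ → ℕ → ℕ → ℕ
  lastColumnShift s n j = if j ≡ᵇ n then s else 0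

  shifted : ∀ s n → Fin (suc n) → Fin (suc n) → Carrier
  shifted s n k j = entry (lastColumnShift s n (toℕ j)) (toℕ k) (toℕ j)

  shift-last : ∀ s n → lastColumnShift s n n ≡ s
  shift-last s n = ≡.cong (λ b → if b then s else 0) (≡ᵇ-refl n)

  shift-below : ∀ s {n j} → j < n → lastColumnShift s n j ≡ 0
  shift-below s j<n = ≡.cong (λ b → if b then s else 0) (≢⇒≡ᵇ-false (<⇒≢ j<n))

  detMatrix : ℕ → Carrier
  detMatrix n = det R n (matrix n)

  detShifted : ℕ → ℕ → Carrier
  detShifted s n = det R (suc n) (shifted s n)

  expansionTerm : ∀ s n → Fin (suc n) → Carrier
  expansionTerm s n x = shifted s n (fromℕ n) x *
    (pow R (- 1#) (countFrom x) * det R n (lastRowMinor (shifted s n) x))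

  shifted-corner : ∀ s n → shifted s n (fromℕ n) (fromℕ n) ≈ y (suc s)
  shifted-corner s n rewrite toℕ-fromℕ n | shift-last s n = begin
    entry s n n                                    ≡⟨ entry-≤ s {n} {n} ≤-refl ⟩
    pow R ι (n ∸ n) * y (suc (n ∸ n ℕ.+ s))        ≡⟨ ≡.cong (λ d → pow R ι d * y (suc (d ℕ.+ s))) (n∸n≡0 n) ⟩
    1# * y (suc s)                                 ≈⟨ *-identityˡ _ ⟩
    y (suc s)                                      ∎

  expansionTerm-last : ∀ s n → expansionTerm s n (fromℕ n) ≈ y (suc s) * detMatrix n
  expansionTerm-last s n = *-cong (shifted-corner s n) (begin
    pow R (- 1#) (countFrom (fromℕ n)) * det R n (lastRowMinor (shifted s n) (fromℕ n))
      ≈⟨ *-cong (reflexive (≡.cong (pow R (- 1#)) (countFrom-last n))) (det-cong minor) ⟩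
    1# * detMatrix n  ≈⟨ *-identityˡ _ ⟩
    detMatrix n       ∎)
    where
    minor : ∀ i j → lastRowMinor (shifted s n) (fromℕ n) i j ≈ matrix n i j
    minor i j rewrite toℕ-punchIn-fromℕ i | toℕ-punchIn-fromℕ j | shift-below s (toℕ<n j) = refl

  expansionTerm-penultimate : ∀ s n →
    expansionTerm s (suc n) (punchIn (fromℕ (suc n)) (fromℕ n)) ≈ ofℕ R (suc n) * detShifted (suc s) n
  expansionTerm-penultimate s n = begin
    shifted s (suc n) (fromℕ (suc n)) x * (pow R (- 1#) (countFrom x) * det R (suc n) (lastRowMinor (shifted s (suc n)) x))
      ≈⟨ *-cong subdiagonal (*-cong (reflexive (≡.cong (pow R (- 1#)) (countFrom-penultimate n)))
           (trans (det-cong minor) (trans (det-scale-columns scale (shifted (suc s) n)) (*-congʳ scale-product)))) ⟩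
    (ι * o) * ((- 1# * 1#) * (ι * E))
      ≈⟨ solve 4 (λ i o u e → (i ⊕ o) ⊕ ((u ⊕ unit) ⊕ (i ⊕ e)) ⊜ ((i ⊕ i) ⊕ u) ⊕ (o ⊕ e)) refl ι o (- 1#) E ⟩
    ((ι * ι) * - 1#) * (o * E)
      ≈⟨ *-congʳ (trans (*-congʳ ι²) (trans (-1*x≈-x (- 1#)) (-‿involutive 1#))) ⟩
    1# * (o * E)  ≈⟨ *-identityˡ _ ⟩
    o * E         ∎
    where
    x = punchIn (fromℕ (suc n)) (fromℕ n)
    o = ofℕ R (suc n)
    E = detShifted (suc s) n

    toℕ-x : toℕ x ≡ n
    toℕ-x = ≡.trans (toℕ-punchIn-fromℕ (fromℕ n)) (toℕ-fromℕ n)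

    subdiagonal : shifted s (suc n) (fromℕ (suc n)) x ≈ ι * o
    subdiagonal rewrite toℕ-x | toℕ-fromℕ n = reflexive (entry-subdiagonal _ n)

    scale : Fin (suc n) → Carrier
    scale j = if toℕ j ≡ᵇ n then ι else 1#

    scale-product : ∏.sum scale ≈ ι
    scale-product = trans
      (∏.sum-only (fromℕ n) {scale} λ j → reflexive (≡.cong (λ b → if b then ι else 1#)
        (≡.trans (≡.cong (_≡ᵇ n) (toℕ-punchIn-fromℕ j)) (≢⇒≡ᵇ-false (<⇒≢ (toℕ<n j))))))
      (reflexive (≡.cong (λ b → if b then ι else 1#)
        (≡.trans (≡.cong (_≡ᵇ n) (toℕ-fromℕ n)) (≡ᵇ-refl n))))

    minor : ∀ i j → lastRowMinor (shifted s (suc n)) x i j ≈ scale j * shifted (suc s) n i j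
    minor i j with punchIn-view (fromℕ n) j
    -- The last column of the minor is column n + 1 of the larger matrix, moved to index n.
    ... | inj₁ ≡.refl
      rewrite toℕ-punchIn-fromℕ i
            | toℕ-punchIn-≥ x (fromℕ n) (≤-reflexive (≡.trans toℕ-x (≡.sym (toℕ-fromℕ n))))
            | toℕ-fromℕ n | ≡ᵇ-refl n = entry-extend-column s (≤-pred (toℕ<n i))
    -- Columns before the deleted one keep their index and have shift 0 in both matrices.
    ... | inj₂ (j′ , ≡.refl)
      rewrite toℕ-punchIn-fromℕ i
            | toℕ-punchIn-< x (punchIn (fromℕ n) j′)
                (≡.subst₂ _<_ (≡.sym (toℕ-punchIn-fromℕ j′)) (≡.sym toℕ-x) (toℕ<n j′))
            | toℕ-punchIn-fromℕ j′ | ≢⇒≡ᵇ-false (<⇒≢ (toℕ<n j′))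
            | ≢⇒≡ᵇ-false (<⇒≢ (ℕₚ.m≤n⇒m≤1+n (toℕ<n j′))) = sym (*-identityˡ _)

  expansionTerm-low : ∀ s n j → expansionTerm s (suc n) (punchIn (fromℕ (suc n)) (punchIn (fromℕ n) j)) ≈ 0#
  expansionTerm-low s n j = trans (*-congʳ (reflexive (entry-low _ low))) (zeroˡ _)
    where
    low : suc (toℕ (punchIn (fromℕ (suc n)) (punchIn (fromℕ n) j))) < toℕ (fromℕ (suc n))
    low rewrite toℕ-punchIn-fromℕ (punchIn (fromℕ n) j) | toℕ-punchIn-fromℕ j = s<s (toℕ<fromℕ j)

  det-recursion : Recursion y detMatrix detShifted
  det-recursion = record
    { D-zero = trans (+-identityʳ _) (*-identityˡ 1#)
    ; D-suc  = λ n → det-cong {suc n} λ i j → reflexive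
        (≡.cong (λ s → entry s (toℕ i) (toℕ j)) (≡.sym (shift-zero n (toℕ j))))
    ; E-zero = λ s → trans (det-last-row (shifted s 0))
        (trans (+-identityʳ _) (expansionTerm-last s 0))
    ; E-suc  = λ s n → trans (det-last-row (shifted s (suc n)))
        (trans (∑.sum-remove {i = fromℕ (suc n)} (expansionTerm s (suc n)))
          (+-cong (expansionTerm-last s (suc n))
            (trans (∑.sum-only (fromℕ n) {expansionTerm s (suc n) ∘ punchIn (fromℕ (suc n))} (expansionTerm-low s n))
                   (expansionTerm-penultimate s n))))
    }
    where
    shift-zero : ∀ n j → lastColumnShift 0 n j ≡ 0
    shift-zero n j with j ≡ᵇ n
    ... | true  = ≡.refl
    ... | false = ≡.refl

module CycleSum {c ℓ′} (R : CommutativeRing c ℓ′) (ℓ : ℕ) (Y : Fin ℓ → CommutativeRing.Carrier R) where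
  open CommutativeRing R hiding (zero)
  open RingSums R
  open import Relation.Binary.Reasoning.Setoid setoid

  extended : ℕ → Carrier
  extended zero    = 0#
  extended (suc t) with t <? ℓ
  ... | yes t<ℓ = Y (fromℕ< t<ℓ)
  ... | no _    = 0#

  extended-< : ∀ {t} (t<ℓ : t < ℓ) → extended (suc t) ≡ Y (fromℕ< t<ℓ)
  extended-< {t} t<ℓ with t <? ℓ
  ... | yes p  = ≡.refl
  ... | no t≮ℓ = contradiction t<ℓ t≮ℓ

  extended-> : ∀ {t} → ℓ < t → extended t ≡ 0#
  extended-> {suc t} (s≤s ℓ≤t) with t <? ℓ
  ... | yes t<ℓ = contradiction ℓ≤t (<⇒≱ t<ℓ)
  ... | no _    = ≡.refl

  open Weights *-commutativeMonoid extended

  pow-count : ∀ x (p : Fin n → Bool) → pow R x (count p (allFin n)) ≈ ∏.sum (λ k → if p k then x else 1#)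
  pow-count {n} x p = trans (go (allFin n)) (∏.fold-tabulate {n = n} id _)
    where
    go : ∀ ks → pow R x (count p ks) ≈ ∏.fold ks (λ k → if p k then x else 1#)
    go []       = refl
    go (k ∷ ks) with p k
    ... | true  = *-congˡ (go ks)
    ... | false = trans (go ks) (sym (*-identityˡ _))

  ∏-select : ∀ {m L} (Z : Fin m → Carrier) (L<m : L < m) →
    ∏.sum (λ t → if L ≡ᵇ toℕ t then Z t else 1#) ≈ Z (fromℕ< L<m)
  ∏-select {suc m} {zero}  Z L<m       = trans (*-congˡ (∏.sum-ε {n = m} (λ _ → refl))) (*-identityʳ _)
  ∏-select {suc m} {suc L} Z (s<s L<m) = trans (*-identityˡ _) (∏-select (Z ∘ suc) L<m)

  ∏-select-length : ∀ {L} → 0 < L → L ≤ ℓ → ∏.sum (λ t → if L ≡ᵇ suc (toℕ t) then Y t else 1#) ≈ extended L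
  ∏-select-length {suc L} _ L<ℓ = trans (∏-select Y L<ℓ) (reflexive (≡.sym (extended-< L<ℓ)))

  monomial : (Fin n → Fin n) → Carrier
  monomial π = ∏ R (allFin ℓ) (λ t → pow R (Y t) (α π (suc (toℕ t))))

  -- Each power of `Y t` is spread over the minima of cycles of that length, and the products over
  -- lengths and points are exchanged. For a fixed minimum a single t survives; `short` puts it in
  -- range.
  monomial≈cycleWeight : ∀ {π : Fin n → Fin n} → IsInjective π → (∀ k → cycleLen π k ≤ ℓ) →
    monomial π ≈ cycleWeight π
  monomial≈cycleWeight {n} {π} π-inj short = begin
    monomial π                                  ≈⟨ ∏-allFin {ℓ} (λ t → pow R (Y t) (α π (suc (toℕ t)))) ⟩
    ∏.sum (λ t → pow R (Y t) (α π (suc (toℕ t)))) ≈⟨ ∏.sum-cong-≋ (λ t → pow-count (Y t) (represents t)) ⟩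
    ∏.sum (λ t → ∏.sum (λ k → contribution t k)) ≈⟨ ∏.∑-comm contribution ⟩
    ∏.sum (λ k → ∏.sum (λ t → contribution t k)) ≈⟨ ∏.sum-cong-≋ collect ⟩
    cycleWeight π ∎
    where
    represents : Fin ℓ → Fin n → Bool
    represents t k = (cycleLen π k ≡ᵇ suc (toℕ t)) ∧ isCycleMin π k

    contribution : Fin ℓ → Fin n → Carrier
    contribution t k = if represents t k then Y t else 1#

    collect : ∀ k → ∏.sum (λ t → contribution t k) ≈ factor π k
    collect k with isCycleMin π k
    ... | true = trans
      (∏.sum-cong-≋ {ℓ} λ t → reflexive (≡.cong (λ b → if b then Y t else 1#) (∧-identityʳ (cycleLen π k ≡ᵇ suc (toℕ t)))))
      (∏-select-length (IsPeriod.positive (cycleLen-isPeriod π-inj k)) (short k))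
    ... | false = ∏.sum-ε {n = ℓ} λ t →
      reflexive (≡.cong (λ b → if b then Y t else 1#) (∧-zeroʳ (cycleLen π k ≡ᵇ suc (toℕ t))))

  -- Only the smallest element of the long cycle carries its factor, so k is replaced by that
  -- element, which has the same period; the factor there is 0.
  long⇒cycleWeight≈0 : ∀ {π : Fin n → Fin n} → IsInjective π → ∀ {k} → ℓ < cycleLen π k → cycleWeight π ≈ 0#
  long⇒cycleWeight≈0 {n = suc n} {π} π-inj {k} long with m , k′-min ← cycleMin-exists π-inj k =
    trans (∏.sum-remove {i = k′} (factor π)) (trans (*-congʳ factor≈0) (zeroˡ _))
    where
    k′ = iter π m k
    factor≈0 : factor π k′ ≈ 0#
    factor≈0 = reflexive (≡.trans
      (≡.cong₂ (λ b L → if b then extended L else 1#)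
        (T-iff⇒≡ {y = true} _ (λ _ → isCycleMin⁺ k′-min))
        (cycleLen-unique π-inj (period-iter π-inj (cycleLen-isPeriod π-inj k) m)))
      (extended-> long))

  restricted-monomial≈cycleWeight : ∀ {π : Fin n → Fin n} → IsInjective π →
    (if inC ℓ π then monomial π else 0#) ≈ cycleWeight π
  restricted-monomial≈cycleWeight {n} {π} π-inj with any? (λ k → ℓ <? cycleLen π k)
  ... | yes (k , long) = trans
    (reflexive (≡.cong (λ b → if b then monomial π else 0#) (¬T⇒≡false λ t →
      <⇒≱ long (≤ᵇ⇒≤ _ _ (all⁻ (λ k → cycleLen π k ≤ᵇ ℓ) (allFin n) t (∈-allFin k))))))
    (sym (long⇒cycleWeight≈0 π-inj long))
  ... | no ¬long = trans
    (reflexive (≡.cong (λ b → if b then monomial π else 0#)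
      (T-iff⇒≡ {y = true} _ λ _ → all⁺ (λ k → cycleLen π k ≤ᵇ ℓ) (allFin n) λ {k} _ → ≤⇒≤ᵇ (short k))))
    (monomial≈cycleWeight π-inj short)
    where
    short : ∀ k → cycleLen π k ≤ ℓ
    short k = ≮⇒≥ λ long → ¬long (k , long)

  cycleSum≈permSum : ∀ n → cycleSum R n ℓ Y ≈ permSum extended n
  cycleSum≈permSum n = trans (∑.fold-filter (inC ℓ) (perms n) monomial)
    (∑.fold-cong (All.map restricted-monomial≈cycleWeight (perms-isInjective n)))

theorem7p2 : ∀ {c ℓ′} (R : CommutativeRing c ℓ′) (ι : CommutativeRing.Carrier R) →
    CommutativeRing._≈_ R (CommutativeRing._*_ R ι ι) (CommutativeRing.-_ R (CommutativeRing.1# R)) →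
    (n ℓ : ℕ) → 1 ≤ n → ℓ ≤ n → (Y : Fin ℓ → CommutativeRing.Carrier R) →
    CommutativeRing._≈_ R (det R n (M R ι n ℓ Y)) (cycleSum R n ℓ Y)
theorem7p2 R ι ι² n ℓ _ _ Y = begin
  det R n (M R ι n ℓ Y)  ≈⟨ det-cong M≈matrix ⟩
  detMatrix n            ≈⟨ recursion-unique extended det-recursion (cycle-recursion extended) n ⟩
  permSum extended n     ≈⟨ sym (cycleSum≈permSum n) ⟩
  cycleSum R n ℓ Y       ∎
  where
  open CommutativeRing R hiding (zero)
  open RingSums R
  open CycleSum R ℓ Y
  open Hessenberg R ι ι² extended
  open import Relation.Binary.Reasoning.Setoid setoid

  M≈matrix : ∀ k j → M R ι n ℓ Y k j ≈ matrix n k j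
  M≈matrix k j with toℕ k ≤? toℕ j | (toℕ j ∸ toℕ k) <? ℓ
  ... | yes _   | yes d<ℓ rewrite ℕₚ.+-identityʳ (toℕ j ∸ toℕ k) =
    *-congˡ (reflexive (≡.sym (extended-< d<ℓ)))
  -- Beyond the band `M` falls to its last clause, where k ≤ j excludes the subdiagonal; the other
  -- side vanishes through `extended`.
  ... | yes k≤j | no d≮ℓ
    rewrite ℕₚ.+-identityʳ (toℕ j ∸ toℕ k) | ≢⇒≡ᵇ-false (<⇒≢ (s≤s k≤j)) =
    sym (trans (*-congˡ (reflexive (extended-> (s≤s (≮⇒≥ d≮ℓ))))) (zeroʳ _))
  ... | no _    | yes _ = refl
  ... | no _    | no _  = refl
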